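{- Let $(\lambda_n)_{n\in\mathbb{N}}$ be a sequence of real numbers satisfying the condition $\inf\{|\lambda_m-\lambda_n| : m,n\in\mathbb{N},\ m\neq n\}>0$. Then, for almost all real numbers $\alpha$ (with respect to Lebesgue measure), the function $\mathbb{N}\to\mathbb{R}$, $n\mapsto\alpha\lambda_n$, is not uniformly close to any function $\mathbb{N}\to\mathbb{Z}$ having integral difference ratios.
   Context: $\mathbb{N}$ denotes the non-negative integers. A function $f:\mathbb{N}\to\mathbb{Z}$ has integral difference ratios if $a-b$ divides $f(a)-f(b)$ for all $a,b\in\mathbb{N}$ with $a\neq b$. Two functions $f,g:\mathbb{N}\to\mathbb{R}$ are uniformly close if $f-g$ is bounded, i.e. there exists $M$ such that $|f(x)-g(x)|\leq M$ for all $x\in\mathbb{N}$. -}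

module Defs where

open import Data.Integer as ℤ using (ℤ)
open import Data.Integer.Divisibility.Signed using (_∣_)
open import Data.Nat as ℕ using (ℕ; zero; suc)
import Data.Nat.Properties as ℕ
open import Data.Product using (Σ-syntax; ∃-syntax; _×_; _,_)
open import Data.Rational as ℚ using (ℚ; 0ℚ; 1ℚ; ½)
import Data.Rational.Properties as ℚ
open import Data.Rational.Solver using (module +-*-Solver)
open import Data.Sum using (inj₁; inj₂)
open import Function.Bundles using (_⇔_; mk⇔)
open import Level as L using (0ℓ)
open import Relation.Binary.PropositionalEquality
  using (_≡_; _≢_; refl; sym; trans; cong; cong₂; subst)
open import Relation.Nullary using (¬_)
open import Relation.Unary using (Pred)

private
  open +-*-Solver using (solve; _:+_; _:*_; _:-_; :-_; _:=_; con)

  halves : ∀ p → ½ ℚ.* p ℚ.+ ½ ℚ.* p ≡ p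
  halves = solve 1 (λ p → con ½ :* p :+ con ½ :* p := p) refl

  ½*-pos : ∀ {p} → 0ℚ ℚ.< p → 0ℚ ℚ.< ½ ℚ.* p
  ½*-pos {p} 0<p = subst (ℚ._< ½ ℚ.* p) (ℚ.*-zeroʳ ½) (ℚ.*-monoʳ-<-pos ½ 0<p)

  abs-≤ : ∀ {p q} → p ℚ.≤ q → ℚ.- p ℚ.≤ q → ℚ.∣ p ∣ ℚ.≤ q
  abs-≤ {p} p≤q -p≤q with ℚ.∣p∣≡p∨∣p∣≡-p p
  ... | inj₁ eq = subst (ℚ._≤ _) (sym eq) p≤q
  ... | inj₂ eq = subst (ℚ._≤ _) (sym eq) -p≤q

  ∣p∣-∣q∣≤∣p-q∣ : ∀ p q → ℚ.∣ p ∣ ℚ.- ℚ.∣ q ∣ ℚ.≤ ℚ.∣ p ℚ.- q ∣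
  ∣p∣-∣q∣≤∣p-q∣ p q = begin
    ℚ.∣ p ∣ ℚ.- ℚ.∣ q ∣                        ≡⟨ cong (λ r → ℚ.∣ r ∣ ℚ.- ℚ.∣ q ∣) (p≡p-q+q p q) ⟩
    ℚ.∣ (p ℚ.- q) ℚ.+ q ∣ ℚ.- ℚ.∣ q ∣          ≤⟨ ℚ.+-monoˡ-≤ (ℚ.- ℚ.∣ q ∣) (ℚ.∣p+q∣≤∣p∣+∣q∣ (p ℚ.- q) q) ⟩
    (ℚ.∣ p ℚ.- q ∣ ℚ.+ ℚ.∣ q ∣) ℚ.- ℚ.∣ q ∣    ≡⟨ cancel ℚ.∣ p ℚ.- q ∣ ℚ.∣ q ∣ ⟩
    ℚ.∣ p ℚ.- q ∣                              ∎
    where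
    open ℚ.≤-Reasoning
    p≡p-q+q : ∀ p q → p ≡ (p ℚ.- q) ℚ.+ q
    p≡p-q+q = solve 2 (λ p q → p := (p :- q) :+ q) refl
    cancel : ∀ a b → (a ℚ.+ b) ℚ.- b ≡ a
    cancel = solve 2 (λ a b → (a :+ b) :- b := a) refl

  neg-minus : ∀ p q → ℚ.- (p ℚ.- q) ≡ q ℚ.- p
  neg-minus = solve 2 (λ p q → :- (p :- q) := q :- p) refl

  ∣∣-swap : ∀ p q → ℚ.∣ p ℚ.- q ∣ ≡ ℚ.∣ q ℚ.- p ∣
  ∣∣-swap p q = trans (sym (ℚ.∣-p∣≡∣p∣ (p ℚ.- q))) (cong ℚ.∣_∣ (neg-minus p q))

  ∣∣-contract : ∀ p q → ℚ.∣ ℚ.∣ p ∣ ℚ.- ℚ.∣ q ∣ ∣ ℚ.≤ ℚ.∣ p ℚ.- q ∣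
  ∣∣-contract p q = abs-≤ (∣p∣-∣q∣≤∣p-q∣ p q) (begin
    ℚ.- (ℚ.∣ p ∣ ℚ.- ℚ.∣ q ∣)  ≡⟨ neg-minus ℚ.∣ p ∣ ℚ.∣ q ∣ ⟩
    ℚ.∣ q ∣ ℚ.- ℚ.∣ p ∣        ≤⟨ ∣p∣-∣q∣≤∣p-q∣ q p ⟩
    ℚ.∣ q ℚ.- p ∣              ≡⟨ ∣∣-swap q p ⟩
    ℚ.∣ p ℚ.- q ∣              ∎)
    where open ℚ.≤-Reasoning

IsCauchy : (ℕ → ℚ) → Set
IsCauchy x = ∀ ε → 0ℚ ℚ.< ε →
  ∃[ N ] ∀ m n → N ℕ.≤ m → N ℕ.≤ n → ℚ.∣ x m ℚ.- x n ∣ ℚ.≤ ε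

private abstract
  const-cauchy : ∀ q → IsCauchy (λ _ → q)
  const-cauchy q ε 0<ε = 0 , λ _ _ _ _ →
    subst (λ r → ℚ.∣ r ∣ ℚ.≤ ε) (sym (ℚ.+-inverseʳ q)) (ℚ.<⇒≤ 0<ε)

  +-cauchy : ∀ x y → IsCauchy x → IsCauchy y → IsCauchy (λ n → x n ℚ.+ y n)
  +-cauchy x y cx cy ε 0<ε with cx (½ ℚ.* ε) (½*-pos 0<ε) | cy (½ ℚ.* ε) (½*-pos 0<ε)
  ... | Nx , hx | Ny , hy = Nx ℕ.⊔ Ny , λ m n N≤m N≤n → begin
    ℚ.∣ (x m ℚ.+ y m) ℚ.- (x n ℚ.+ y n) ∣
      ≡⟨ cong ℚ.∣_∣ (rearrange (x m) (y m) (x n) (y n)) ⟩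
    ℚ.∣ (x m ℚ.- x n) ℚ.+ (y m ℚ.- y n) ∣
      ≤⟨ ℚ.∣p+q∣≤∣p∣+∣q∣ (x m ℚ.- x n) (y m ℚ.- y n) ⟩
    ℚ.∣ x m ℚ.- x n ∣ ℚ.+ ℚ.∣ y m ℚ.- y n ∣
      ≤⟨ ℚ.+-mono-≤
           (hx m n (ℕ.m⊔n≤o⇒m≤o Nx Ny N≤m) (ℕ.m⊔n≤o⇒m≤o Nx Ny N≤n))
           (hy m n (ℕ.m⊔n≤o⇒n≤o Nx Ny N≤m) (ℕ.m⊔n≤o⇒n≤o Nx Ny N≤n)) ⟩
    ½ ℚ.* ε ℚ.+ ½ ℚ.* ε
      ≡⟨ halves ε ⟩
    ε ∎
    where
    open ℚ.≤-Reasoning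
    rearrange : ∀ a b c d → (a ℚ.+ b) ℚ.- (c ℚ.+ d) ≡ (a ℚ.- c) ℚ.+ (b ℚ.- d)
    rearrange = solve 4 (λ a b c d → (a :+ b) :- (c :+ d) := (a :- c) :+ (b :- d)) refl

  neg-cauchy : ∀ x → IsCauchy x → IsCauchy (λ n → ℚ.- x n)
  neg-cauchy x cx ε 0<ε with cx ε 0<ε
  ... | N , h = N , λ m n N≤m N≤n →
    subst (ℚ._≤ ε) (trans (∣∣-swap (x m) (x n)) (cong ℚ.∣_∣ (rearrange (x m) (x n)))) (h m n N≤m N≤n)
    where
    rearrange : ∀ a b → b ℚ.- a ≡ (ℚ.- a) ℚ.- (ℚ.- b)
    rearrange = solve 2 (λ a b → b :- a := (:- a) :- (:- b)) refl

  abs-cauchy : ∀ x → IsCauchy x → IsCauchy (λ n → ℚ.∣ x n ∣)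
  abs-cauchy x cx ε 0<ε with cx ε 0<ε
  ... | N , h = N , λ m n N≤m N≤n →
    ℚ.≤-trans (∣∣-contract (x m) (x n)) (h m n N≤m N≤n)

  eventually-bounded : ∀ x → IsCauchy x →
    ∃[ N ] ∃[ B ] (0ℚ ℚ.< B) × (∀ n → N ℕ.≤ n → ℚ.∣ x n ∣ ℚ.≤ B)
  eventually-bounded x cx with cx 1ℚ (ℚ.positive⁻¹ 1ℚ)
  ... | N , h = N , ℚ.∣ x N ∣ ℚ.+ 1ℚ , 0<B , λ n N≤n → begin
    ℚ.∣ x n ∣                            ≡⟨ cong ℚ.∣_∣ (split (x N) (x n)) ⟩
    ℚ.∣ x N ℚ.+ (x n ℚ.- x N) ∣          ≤⟨ ℚ.∣p+q∣≤∣p∣+∣q∣ (x N) (x n ℚ.- x N) ⟩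
    ℚ.∣ x N ∣ ℚ.+ ℚ.∣ x n ℚ.- x N ∣      ≤⟨ ℚ.+-monoʳ-≤ ℚ.∣ x N ∣ (h n N N≤n ℕ.≤-refl) ⟩
    ℚ.∣ x N ∣ ℚ.+ 1ℚ                     ∎
    where
    open ℚ.≤-Reasoning
    split : ∀ a b → b ≡ a ℚ.+ (b ℚ.- a)
    split = solve 2 (λ a b → b := a :+ (b :- a)) refl
    0<B : 0ℚ ℚ.< ℚ.∣ x N ∣ ℚ.+ 1ℚ
    0<B = ℚ.+-mono-≤-< (ℚ.0≤∣p∣ (x N)) (ℚ.positive⁻¹ 1ℚ)

  module _ (p B : ℚ) (0<p : 0ℚ ℚ.< p) (0<B : 0ℚ ℚ.< B) where
    private instance
      B-pos : ℚ.Positive B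
      B-pos = ℚ.positive 0<B
      p-pos : ℚ.Positive p
      p-pos = ℚ.positive 0<p
      B≢0 : ℚ.NonZero B
      B≢0 = ℚ.pos⇒nonZero B

    quot : ℚ
    quot = p ℚ.* ℚ.1/ B

    quot-pos : 0ℚ ℚ.< quot
    quot-pos = subst (ℚ._< quot) (ℚ.*-zeroʳ p)
      (ℚ.*-monoʳ-<-pos p (ℚ.positive⁻¹ (ℚ.1/ B) {{ℚ.1/pos⇒pos B}}))

    quot-* : B ℚ.* quot ≡ p
    quot-* = trans (ℚ.*-comm B quot)
      (trans (ℚ.*-assoc p (ℚ.1/ B) B)
        (trans (cong (p ℚ.*_) (ℚ.*-inverseˡ B)) (ℚ.*-identityʳ p)))

  *-mono-abs : ∀ {p q B δ} → 0ℚ ℚ.< B → ℚ.∣ p ∣ ℚ.≤ B → ℚ.∣ q ∣ ℚ.≤ δ → ℚ.∣ p ℚ.* q ∣ ℚ.≤ B ℚ.* δ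
  *-mono-abs {p} {q} {B} {δ} 0<B p≤B q≤δ = begin
    ℚ.∣ p ℚ.* q ∣          ≡⟨ ℚ.∣p*q∣≡∣p∣*∣q∣ p q ⟩
    ℚ.∣ p ∣ ℚ.* ℚ.∣ q ∣    ≤⟨ ℚ.*-monoʳ-≤-nonNeg ℚ.∣ q ∣ {{ℚ.∣-∣-nonNeg q}} p≤B ⟩
    B ℚ.* ℚ.∣ q ∣          ≤⟨ ℚ.*-monoˡ-≤-nonNeg B {{ℚ.nonNegative (ℚ.<⇒≤ 0<B)}} q≤δ ⟩
    B ℚ.* δ                ∎
    where open ℚ.≤-Reasoning

  *-rearrange : ∀ a b c d → a ℚ.* b ℚ.- c ℚ.* d ≡ a ℚ.* (b ℚ.- d) ℚ.+ d ℚ.* (a ℚ.- c)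
  *-rearrange = solve 4 (λ a b c d → a :* b :- c :* d := a :* (b :- d) :+ d :* (a :- c)) refl

  *-cauchy : ∀ x y → IsCauchy x → IsCauchy y → IsCauchy (λ n → x n ℚ.* y n)
  *-cauchy x y cx cy ε 0<ε =
    let Kx , A , 0<A , bx = eventually-bounded x cx
        Ky , B , 0<B , by = eventually-bounded y cy
        0<½ε = ½*-pos 0<ε
        Nx , hx = cx (quot (½ ℚ.* ε) B 0<½ε 0<B) (quot-pos (½ ℚ.* ε) B 0<½ε 0<B)
        Ny , hy = cy (quot (½ ℚ.* ε) A 0<½ε 0<A) (quot-pos (½ ℚ.* ε) A 0<½ε 0<A)
        K = Kx ℕ.⊔ Ky
        N = Nx ℕ.⊔ Ny
    in K ℕ.⊔ N , λ m n K⊔N≤m K⊔N≤n →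
      let K≤m = ℕ.m⊔n≤o⇒m≤o K N K⊔N≤m
          N≤m = ℕ.m⊔n≤o⇒n≤o K N K⊔N≤m
          K≤n = ℕ.m⊔n≤o⇒m≤o K N K⊔N≤n
          N≤n = ℕ.m⊔n≤o⇒n≤o K N K⊔N≤n
      in product-close {x m} {y m} {x n} {y n} {½ ℚ.* ε} {A} {B} 0<A 0<B
           (bx m (ℕ.m⊔n≤o⇒m≤o Kx Ky K≤m))
           (by n (ℕ.m⊔n≤o⇒n≤o Kx Ky K≤n))
           (hx m n (ℕ.m⊔n≤o⇒m≤o Nx Ny N≤m) (ℕ.m⊔n≤o⇒m≤o Nx Ny N≤n))
           (hy m n (ℕ.m⊔n≤o⇒n≤o Nx Ny N≤m) (ℕ.m⊔n≤o⇒n≤o Nx Ny N≤n))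
           (quot-* (½ ℚ.* ε) A 0<½ε 0<A) (quot-* (½ ℚ.* ε) B 0<½ε 0<B) (halves ε)
    where
    open ℚ.≤-Reasoning
    product-close : ∀ {a b c d η A B δ δ′ ε} → 0ℚ ℚ.< A → 0ℚ ℚ.< B →
      ℚ.∣ a ∣ ℚ.≤ A → ℚ.∣ d ∣ ℚ.≤ B → ℚ.∣ a ℚ.- c ∣ ℚ.≤ δ′ → ℚ.∣ b ℚ.- d ∣ ℚ.≤ δ →
      A ℚ.* δ ≡ η → B ℚ.* δ′ ≡ η → η ℚ.+ η ≡ ε → ℚ.∣ a ℚ.* b ℚ.- c ℚ.* d ∣ ℚ.≤ ε
    product-close {a} {b} {c} {d} {η} {A} {B} {δ} {δ′} {ε} 0<A 0<B a≤A d≤B ac≤δ′ bd≤δ Aδ≡η Bδ′≡η η+η≡ε = begin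
      ℚ.∣ a ℚ.* b ℚ.- c ℚ.* d ∣
        ≡⟨ cong ℚ.∣_∣ (*-rearrange a b c d) ⟩
      ℚ.∣ a ℚ.* (b ℚ.- d) ℚ.+ d ℚ.* (a ℚ.- c) ∣
        ≤⟨ ℚ.∣p+q∣≤∣p∣+∣q∣ (a ℚ.* (b ℚ.- d)) (d ℚ.* (a ℚ.- c)) ⟩
      ℚ.∣ a ℚ.* (b ℚ.- d) ∣ ℚ.+ ℚ.∣ d ℚ.* (a ℚ.- c) ∣
        ≤⟨ ℚ.+-mono-≤ (*-mono-abs {a} {b ℚ.- d} 0<A a≤A bd≤δ) (*-mono-abs {d} {a ℚ.- c} 0<B d≤B ac≤δ′) ⟩
      A ℚ.* δ ℚ.+ B ℚ.* δ′
        ≡⟨ cong₂ ℚ._+_ Aδ≡η Bδ′≡η ⟩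
      η ℚ.+ η
        ≡⟨ η+η≡ε ⟩
      ε ∎

-- Real numbers as Cauchy sequences of rationals.  The equality of real
-- numbers is _≃_; all the operations and relations below respect it.
record ℝ : Set where
  constructor mkℝ
  field
    seq    : ℕ → ℚ
    cauchy : IsCauchy seq

open ℝ public

infix  4 _≃_ _≤_ _<_
infix  8 -_
infixl 7 _*_
infixl 6 _+_ _-_

_≃_ _≤_ _<_ : ℝ → ℝ → Set
x ≃ y = ∀ ε → 0ℚ ℚ.< ε → ∃[ N ] ∀ n → N ℕ.≤ n → ℚ.∣ seq x n ℚ.- seq y n ∣ ℚ.≤ ε
x ≤ y = ∀ ε → 0ℚ ℚ.< ε → ∃[ N ] ∀ n → N ℕ.≤ n → seq x n ℚ.≤ seq y n ℚ.+ ε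
x < y = ∃[ ε ] (0ℚ ℚ.< ε) × (∃[ N ] ∀ n → N ℕ.≤ n → seq x n ℚ.+ ε ℚ.≤ seq y n)

fromℚ : ℚ → ℝ
fromℚ q = mkℝ (λ _ → q) (const-cauchy q)

fromℤ : ℤ → ℝ
fromℤ k = fromℚ (k ℚ./ 1)

0ℝ : ℝ
0ℝ = fromℚ 0ℚ

-_ ∣_∣ : ℝ → ℝ
- x   = mkℝ (λ n → ℚ.- seq x n) (neg-cauchy (seq x) (cauchy x))
∣ x ∣ = mkℝ (λ n → ℚ.∣ seq x n ∣) (abs-cauchy (seq x) (cauchy x))

_+_ _*_ _-_ : ℝ → ℝ → ℝ
x + y = mkℝ (λ n → seq x n ℚ.+ seq y n) (+-cauchy (seq x) (seq y) (cauchy x) (cauchy y))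
x * y = mkℝ (λ n → seq x n ℚ.* seq y n) (*-cauchy (seq x) (seq y) (cauchy x) (cauchy y))
x - y = x + (- y)

IsLowerBound : Pred ℝ 0ℓ → ℝ → Set
IsLowerBound S b = ∀ r → S r → b ≤ r

IsInfimum : Pred ℝ 0ℓ → ℝ → Set
IsInfimum S ι = IsLowerBound S ι × (∀ b → IsLowerBound S b → b ≤ ι)

-- c < inf S.  Constructively, a set of reals that is inhabited and bounded
-- below need not have an infimum; this says that the infimum exceeds c without
-- presupposing its existence, and inf>⇔ shows that it means just that as soon
-- as the infimum exists.
inf_>_ : Pred ℝ 0ℓ → ℝ → Set
inf S > c = ∃[ δ ] (c < δ) × IsLowerBound S δ

private
  <-≤-trans : ∀ {x y z} → x < y → y ≤ z → x < z
  <-≤-trans {x} {y} {z} (ε , 0<ε , N , x<y) y≤z with y≤z (½ ℚ.* ε) (½*-pos 0<ε)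
  ... | M , h = ½ ℚ.* ε , ½*-pos 0<ε , N ℕ.⊔ M , λ n le → begin
    seq x n ℚ.+ ½ ℚ.* ε                    ≡⟨ rearrange (seq x n) ε ⟩
    (seq x n ℚ.+ ε) ℚ.- ½ ℚ.* ε            ≤⟨ ℚ.+-monoˡ-≤ (ℚ.- (½ ℚ.* ε))
                                                (ℚ.≤-trans (x<y n (ℕ.m⊔n≤o⇒m≤o N M le)) (h n (ℕ.m⊔n≤o⇒n≤o N M le))) ⟩
    (seq z n ℚ.+ ½ ℚ.* ε) ℚ.- ½ ℚ.* ε      ≡⟨ cancel (seq z n) (½ ℚ.* ε) ⟩
    seq z n                                ∎
    where
    open ℚ.≤-Reasoning
    rearrange : ∀ a e → a ℚ.+ ½ ℚ.* e ≡ (a ℚ.+ e) ℚ.- ½ ℚ.* e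
    rearrange = solve 2 (λ a e → a :+ con ½ :* e := (a :+ e) :- con ½ :* e) refl
    cancel : ∀ a b → (a ℚ.+ b) ℚ.- b ≡ a
    cancel = solve 2 (λ a b → (a :+ b) :- b := a) refl

inf>⇔ : ∀ {S ι} → IsInfimum S ι → ∀ c → (inf S > c) ⇔ (c < ι)
inf>⇔ {S} {ι} (lower , greatest) c = mk⇔
  (λ { (δ , c<δ , δ≤S) → <-≤-trans {c} {δ} {ι} c<δ (greatest δ δ≤S) })
  (λ c<ι → ι , c<ι , lower)

Distances : (ℕ → ℝ) → Pred ℝ 0ℓ
Distances x r = ∃[ m ] ∃[ n ] (m ≢ n) × (r ≃ ∣ x m - x n ∣)

IntegralDifferenceRatios : (ℕ → ℤ) → Set
IntegralDifferenceRatios f =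
  ∀ a b → a ≢ b → (ℤ.+ a ℤ.- ℤ.+ b) ∣ (f a ℤ.- f b)

UniformlyClose : (ℕ → ℝ) → (ℕ → ℝ) → Set
UniformlyClose f g = ∃[ M ] ∀ x → ∣ f x - g x ∣ ≤ M

sum : ℕ → (ℕ → ℝ) → ℝ
sum zero      x = 0ℝ
sum (suc k) x = sum k x + x k

-- Lebesgue null sets: outer measure zero.  The intervals are ]a i , b i[, and
-- "total length ≤ ε" is expressed by bounding all the finite partial sums.
Null : Pred ℝ 0ℓ → Set
Null E = ∀ ε → 0ℝ < ε →
  Σ[ a ∈ (ℕ → ℝ) ] Σ[ b ∈ (ℕ → ℝ) ]
    (∀ i → a i ≤ b i)
  × (∀ k → sum k (λ i → b i - a i) ≤ ε)
  × (∀ x → E x → ∃[ i ] (a i < x) × (x < b i))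

AlmostAll : Pred ℝ 0ℓ → Set (L.suc 0ℓ)
AlmostAll P = Σ[ E ∈ Pred ℝ 0ℓ ] Null E × (∀ x → ¬ E x → P x)

module Submission where

-- Let f have integral difference ratios, with |α Λ n - f n| and |α| bounded by T.
-- For a fixed modulus m, f (m j) ≡ f 0 modulo m, so α (Λ (m j) - Λ 0) stays
-- within 2T of the multiples of m, for every j.  Taking m large compared with T,
-- this confines α to intervals that fill only a small proportion of the line at
-- the scale 1 / |Λ (m j) - Λ 0|.  By separation these differences are unbounded;
-- along a subsequence that grows fast enough each new constraint at least halves
-- the total length of the intervals left over from the previous ones, so for each
-- T the exceptional α form a null set.  Replacing D (Λ (m j) - Λ 0) by integers,
-- for a large enough D, turns the halving step into integer arithmetic.

import Algebra.Properties.AbelianGroup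
open import Data.Fin as Fin using (Fin)
import Data.Fin.Properties as Fin
open import Data.Integer as ℤ using (ℤ; +_; -[1+_])
import Data.Integer.DivMod as ℤ
open import Data.Integer.Divisibility.Signed using (divides)
import Data.Integer.Properties as ℤ
import Data.Integer.Tactic.RingSolver as ℤ
open import Data.List as List using (List; []; _∷_; length; _++_)
open import Data.List.Membership.Propositional using (_∈_)
import Data.List.Membership.Propositional.Properties as ∈
import Data.List.Properties as List
open import Data.List.Relation.Unary.Any as Any using (Any; here; there)
import Data.List.Relation.Unary.Any.Properties as Any
open import Data.Nat as ℕ using (ℕ; zero; suc)
import Data.Nat.DivMod as ℕ
import Data.Nat.Properties as ℕ
import Data.Nat.Tactic.RingSolver as ℕ
open import Data.Product using (Σ-syntax; ∃-syntax; _×_; _,_; proj₁; proj₂)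
open import Data.Rational as ℚ using (ℚ; mkℚ; 0ℚ; 1ℚ; ½)
import Data.Rational.Properties as ℚ
open import Data.Rational.Solver using (module +-*-Solver)
import Data.Rational.Unnormalised as ℚᵘ
import Data.Rational.Unnormalised.Properties as ℚᵘ
open import Data.Sum using (inj₁; inj₂)
open import Function using (_∘_)
open import Function.Definitions using (Injective)
open import Level using (0ℓ)
open import Relation.Binary.PropositionalEquality
open import Relation.Nullary using (¬_; yes; no; contradiction)
open import Relation.Unary using (Pred)
open import Defs

module ℤ-+ = Algebra.Properties.AbelianGroup ℤ.+-0-abelianGroup
open +-*-Solver using (solve; _:+_; _:*_; _:-_; :-_; _:=_; con)

-- Integers and reciprocals in ℚ

-- Opaque, so that the normalisation hidden in `z ℚ./ 1` is never unfolded; outside this block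
-- `ι≡/1` is the only access to it.
opaque
  ι : ℤ → ℚ
  ι z = z ℚ./ 1

  ι≡/1 : ∀ z → ι z ≡ z ℚ./ 1
  ι≡/1 z = refl

ιᵘ : ∀ z → ℚ.toℚᵘ (ι z) ℚᵘ.≃ ℚᵘ.mkℚᵘ z 0
ιᵘ z = subst (λ q → ℚ.toℚᵘ q ℚᵘ.≃ ℚᵘ.mkℚᵘ z 0) (sym (ι≡/1 z)) (ℚ.toℚᵘ-fromℚᵘ (ℚᵘ.mkℚᵘ z 0))

ι-+ : ∀ i j → ι (i ℤ.+ j) ≡ ι i ℚ.+ ι j
ι-+ i j = ℚ.toℚᵘ-injective (begin
  ℚ.toℚᵘ (ι (i ℤ.+ j))                 ≈⟨ ιᵘ (i ℤ.+ j) ⟩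
  ℚᵘ.mkℚᵘ (i ℤ.+ j) 0                  ≡⟨ cong₂ (λ a b → ℚᵘ.mkℚᵘ (a ℤ.+ b) 0) (sym (ℤ.*-identityʳ i)) (sym (ℤ.*-identityʳ j)) ⟩
  ℚᵘ.mkℚᵘ i 0 ℚᵘ.+ ℚᵘ.mkℚᵘ j 0         ≈⟨ ℚᵘ.+-cong (ιᵘ i) (ιᵘ j) ⟨
  ℚ.toℚᵘ (ι i) ℚᵘ.+ ℚ.toℚᵘ (ι j)       ≈⟨ ℚ.toℚᵘ-homo-+ (ι i) (ι j) ⟨
  ℚ.toℚᵘ (ι i ℚ.+ ι j)                 ∎)
  where open ℚᵘ.≃-Reasoning

ι-* : ∀ i j → ι (i ℤ.* j) ≡ ι i ℚ.* ι j
ι-* i j = ℚ.toℚᵘ-injective (begin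
  ℚ.toℚᵘ (ι (i ℤ.* j))                 ≈⟨ ιᵘ (i ℤ.* j) ⟩
  ℚᵘ.mkℚᵘ i 0 ℚᵘ.* ℚᵘ.mkℚᵘ j 0         ≈⟨ ℚᵘ.*-cong (ιᵘ i) (ιᵘ j) ⟨
  ℚ.toℚᵘ (ι i) ℚᵘ.* ℚ.toℚᵘ (ι j)       ≈⟨ ℚ.toℚᵘ-homo-* (ι i) (ι j) ⟨
  ℚ.toℚᵘ (ι i ℚ.* ι j)                 ∎)
  where open ℚᵘ.≃-Reasoning

ι-neg : ∀ i → ι (ℤ.- i) ≡ ℚ.- ι i
ι-neg i = ℚ.toℚᵘ-injective (begin
  ℚ.toℚᵘ (ι (ℤ.- i))                   ≈⟨ ιᵘ (ℤ.- i) ⟩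
  ℚᵘ.- ℚᵘ.mkℚᵘ i 0                     ≈⟨ ℚᵘ.-‿cong (ιᵘ i) ⟨
  ℚᵘ.- ℚ.toℚᵘ (ι i)                    ≈⟨ ℚ.toℚᵘ-homo‿- (ι i) ⟨
  ℚ.toℚᵘ (ℚ.- ι i)                     ∎)
  where open ℚᵘ.≃-Reasoning

ι-minus : ∀ i j → ι (i ℤ.- j) ≡ ι i ℚ.- ι j
ι-minus i j = trans (ι-+ i (ℤ.- j)) (cong (ι i ℚ.+_) (ι-neg j))

ι-mono-≤ : ∀ {i j} → i ℤ.≤ j → ι i ℚ.≤ ι j
ι-mono-≤ {i} {j} i≤j = ℚ.toℚᵘ-cancel-≤ (begin
  ℚ.toℚᵘ (ι i)     ≃⟨ ιᵘ i ⟩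
  ℚᵘ.mkℚᵘ i 0      ≤⟨ ℚᵘ.*≤* (ℤ.*-monoʳ-≤-nonNeg (+ 1) i≤j) ⟩
  ℚᵘ.mkℚᵘ j 0      ≃⟨ ιᵘ j ⟨
  ℚ.toℚᵘ (ι j)     ∎)
  where open ℚᵘ.≤-Reasoning

ι-cancel-< : ∀ {i j} → ι i ℚ.< ι j → i ℤ.< j
ι-cancel-< ιi<ιj = ℤ.≰⇒> λ j≤i → ℚ.<-irrefl refl (ℚ.<-≤-trans ιi<ιj (ι-mono-≤ j≤i))

ι-mono-< : ∀ {i j} → i ℤ.< j → ι i ℚ.< ι j
ι-mono-< {i} {j} i<j = ℚ.toℚᵘ-cancel-< (begin-strict
  ℚ.toℚᵘ (ι i)     ≃⟨ ιᵘ i ⟩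
  ℚᵘ.mkℚᵘ i 0      <⟨ ℚᵘ.*<* (ℤ.*-monoʳ-<-pos (+ 1) i<j) ⟩
  ℚᵘ.mkℚᵘ j 0      ≃⟨ ιᵘ j ⟨
  ℚ.toℚᵘ (ι j)     ∎)
  where open ℚᵘ.≤-Reasoning

ν : ℕ → ℚ
ν n = ι (+ n)

ν-* : ∀ m n → ν (m ℕ.* n) ≡ ν m ℚ.* ν n
ν-* m n = trans (cong ι (ℤ.pos-* m n)) (ι-* (+ m) (+ n))

0≤ν : ∀ n → 0ℚ ℚ.≤ ν n
0≤ν n = subst (ℚ._≤ ν n) (ι≡/1 (+ 0)) (ι-mono-≤ (ℤ.+≤+ ℕ.z≤n))

ν-suc : ∀ n → ν (suc n) ≡ 1ℚ ℚ.+ ν n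
ν-suc n = trans (ι-+ (+ 1) (+ n)) (cong (ℚ._+ ν n) (ι≡/1 (+ 1)))

ν-mono : ∀ {m n} → m ℕ.≤ n → ν m ℚ.≤ ν n
ν-mono m≤n = ι-mono-≤ (ℤ.+≤+ m≤n)

0<ν : ∀ n .{{_ : ℕ.NonZero n}} → 0ℚ ℚ.< ν n
0<ν n = subst (ℚ._< ν n) (ι≡/1 (+ 0)) (ι-mono-< (ℤ.+<+ (ℕ.>-nonZero⁻¹ n)))

ρ : ∀ n .{{_ : ℕ.NonZero n}} → ℚ
ρ n = (+ 1) ℚ./ n

ν*ρ : ∀ n .{{_ : ℕ.NonZero n}} → ν n ℚ.* ρ n ≡ 1ℚ
ν*ρ n@(suc k) = ℚ.toℚᵘ-injective (begin
  ℚ.toℚᵘ (ν n ℚ.* ρ n)                 ≈⟨ ℚ.toℚᵘ-homo-* (ν n) (ρ n) ⟩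
  ℚ.toℚᵘ (ν n) ℚᵘ.* ℚ.toℚᵘ (ρ n)       ≈⟨ ℚᵘ.*-cong (ιᵘ (+ n)) (ℚ.toℚᵘ-fromℚᵘ (ℚᵘ.mkℚᵘ (+ 1) k)) ⟩
  ℚᵘ.mkℚᵘ (+ n) 0 ℚᵘ.* ℚᵘ.mkℚᵘ (+ 1) k ≈⟨ ℚᵘ.*≡* (trans (ℤ.*-identityʳ _) (trans (ℤ.*-identityʳ (+ n)) (sym (trans (ℤ.*-identityˡ _) (ℤ.*-identityˡ (+ n)))))) ⟩
  ℚᵘ.1ℚᵘ ∎)
  where open ℚᵘ.≃-Reasoning

0<ρ : ∀ n .{{_ : ℕ.NonZero n}} → 0ℚ ℚ.< ρ n
0<ρ n = ℚ.positive⁻¹ (ρ n) {{ℚ.normalize-pos 1 n}}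

*-monoˡ : ∀ {p q} r → 0ℚ ℚ.≤ r → p ℚ.≤ q → r ℚ.* p ℚ.≤ r ℚ.* q
*-monoˡ r 0≤r = ℚ.*-monoˡ-≤-nonNeg r {{ℚ.nonNegative 0≤r}}

*-monoʳ : ∀ {p q} r → 0ℚ ℚ.≤ r → p ℚ.≤ q → p ℚ.* r ℚ.≤ q ℚ.* r
*-monoʳ r 0≤r = ℚ.*-monoʳ-≤-nonNeg r {{ℚ.nonNegative 0≤r}}

-- Division with remainder of the numerator by the denominator.
ι-floor : ∀ q → ∃[ z ] ι z ℚ.≤ q × q ℚ.≤ 1ℚ ℚ.+ ι z
ι-floor q@(mkℚ z d _) = z ℤ./ℕ suc d ,
  ℚ.toℚᵘ-cancel-≤ (begin
    ℚ.toℚᵘ (ι (z ℤ./ℕ suc d))   ≃⟨ ιᵘ (z ℤ./ℕ suc d) ⟩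
    ℚᵘ.mkℚᵘ (z ℤ./ℕ suc d) 0    ≤⟨ ℚᵘ.*≤* (subst ((z ℤ./ℕ suc d) ℤ.* + suc d ℤ.≤_) (sym (ℤ.*-identityʳ z)) (ℤ.[n/ℕd]*d≤n z (suc d))) ⟩
    ℚ.toℚᵘ q                    ∎) ,
  subst (q ℚ.≤_) (trans (ι-+ (+ 1) (z ℤ./ℕ suc d)) (cong (ℚ._+ ι (z ℤ./ℕ suc d)) (ι≡/1 (+ 1)))) (ℚ.toℚᵘ-cancel-≤ (begin
    ℚ.toℚᵘ q                            ≤⟨ ℚᵘ.*≤* (subst (ℤ._≤ ℤ.suc (z ℤ./ℕ suc d) ℤ.* + suc d) (sym (ℤ.*-identityʳ z)) (ℤ.<⇒≤ (ℤ.n<s[n/ℕd]*d z (suc d)))) ⟩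
    ℚᵘ.mkℚᵘ (ℤ.suc (z ℤ./ℕ suc d)) 0    ≃⟨ ιᵘ (ℤ.suc (z ℤ./ℕ suc d)) ⟨
    ℚ.toℚᵘ (ι (ℤ.suc (z ℤ./ℕ suc d)))   ∎))
  where open ℚᵘ.≤-Reasoning

i≤+∣i∣ : ∀ i → i ℤ.≤ + ℤ.∣ i ∣
i≤+∣i∣ (+ n)    = ℤ.≤-refl
i≤+∣i∣ -[1+ n ] = ℤ.-≤+

≤ν : ∀ q → ∃[ n ] q ℚ.≤ ν (suc n)
≤ν q with ι-floor q
... | z , _ , q≤1+z = ℤ.∣ z ∣ , (begin
  q                    ≤⟨ q≤1+z ⟩
  1ℚ ℚ.+ ι z           ≤⟨ ℚ.+-monoʳ-≤ 1ℚ (ι-mono-≤ (i≤+∣i∣ z)) ⟩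
  1ℚ ℚ.+ ν ℤ.∣ z ∣     ≡⟨ ν-suc ℤ.∣ z ∣ ⟨
  ν (suc ℤ.∣ z ∣)      ∎)
  where open ℚ.≤-Reasoning

archimedean : ∀ p q → 0ℚ ℚ.< q → ∃[ n ] p ℚ.≤ ν (suc n) ℚ.* q
archimedean p q 0<q with ≤ν (p ℚ.* q⁻¹)
  where
  q⁻¹ : ℚ
  q⁻¹ = (ℚ.1/ q) {{ℚ.>-nonZero 0<q}}
... | n , p/q≤1+n = n , (begin
  p                                        ≡⟨ ℚ.*-identityʳ p ⟨
  p ℚ.* 1ℚ                                 ≡⟨ cong (p ℚ.*_) (ℚ.*-inverseˡ q) ⟨
  p ℚ.* (ℚ.1/ q ℚ.* q)                     ≡⟨ ℚ.*-assoc p (ℚ.1/ q) q ⟨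
  p ℚ.* ℚ.1/ q ℚ.* q                       ≤⟨ *-monoʳ q (ℚ.<⇒≤ 0<q) p/q≤1+n ⟩
  ν (suc n) ℚ.* q                          ∎)
  where
  open ℚ.≤-Reasoning
  instance
    q≢0 : ℚ.NonZero q
    q≢0 = ℚ.>-nonZero 0<q

abs-≤ : ∀ {p q} → p ℚ.≤ q → ℚ.- p ℚ.≤ q → ℚ.∣ p ∣ ℚ.≤ q
abs-≤ {p} p≤q -p≤q with ℚ.∣p∣≡p∨∣p∣≡-p p
... | inj₁ eq = subst (ℚ._≤ _) (sym eq) p≤q
... | inj₂ eq = subst (ℚ._≤ _) (sym eq) -p≤q

p≤∣p∣ : ∀ p → p ℚ.≤ ℚ.∣ p ∣
p≤∣p∣ p with ℚ.≤-total 0ℚ p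
... | inj₁ 0≤p = ℚ.≤-reflexive (sym (ℚ.0≤p⇒∣p∣≡p 0≤p))
... | inj₂ p≤0 = ℚ.≤-trans p≤0 (ℚ.0≤∣p∣ p)

-p≤∣p∣ : ∀ p → ℚ.- p ℚ.≤ ℚ.∣ p ∣
-p≤∣p∣ p = subst (ℚ.- p ℚ.≤_) (ℚ.∣-p∣≡∣p∣ p) (p≤∣p∣ (ℚ.- p))

-- Null sets from finite rational covers

Eventually : (ℕ → Set) → Set
Eventually P = ∃[ N ] ∀ n → N ℕ.≤ n → P n

Eventually-map : ∀ {P Q : ℕ → Set} → (∀ n → P n → Q n) → Eventually P → Eventually Q
Eventually-map P⇒Q (N , h) = N , λ n N≤n → P⇒Q n (h n N≤n)

Eventually-× : ∀ {P Q : ℕ → Set} → Eventually P → Eventually Q → Eventually (λ n → P n × Q n)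
Eventually-× (M , f) (N , g) = M ℕ.⊔ N , λ n le → f n (ℕ.m⊔n≤o⇒m≤o M N le) , g n (ℕ.m⊔n≤o⇒n≤o M N le)

halve : ℕ → ℚ → ℚ
halve zero    q = q
halve (suc n) q = ½ ℚ.* halve n q

½+½ : ∀ q → ½ ℚ.* q ℚ.+ ½ ℚ.* q ≡ q
½+½ = solve 1 (λ q → con ½ :* q :+ con ½ :* q := q) refl

0≤½ : 0ℚ ℚ.≤ ½
0≤½ = ℚ.nonNegative⁻¹ ½

halve-mono : ∀ n {p q} → p ℚ.≤ q → halve n p ℚ.≤ halve n q
halve-mono zero    p≤q = p≤q
halve-mono (suc n) p≤q = *-monoˡ ½ 0≤½ (halve-mono n p≤q)

*-halve : ∀ p n q → p ℚ.* halve n q ≡ halve n (p ℚ.* q)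
*-halve p zero    q = refl
*-halve p (suc n) q = trans (rearrange p (halve n q)) (cong (½ ℚ.*_) (*-halve p n q))
  where
  rearrange : ∀ p r → p ℚ.* (½ ℚ.* r) ≡ ½ ℚ.* (p ℚ.* r)
  rearrange = solve 2 (λ p r → p :* (con ½ :* r) := con ½ :* (p :* r)) refl

0≤halve : ∀ n {q} → 0ℚ ℚ.≤ q → 0ℚ ℚ.≤ halve n q
0≤halve n 0≤q = ℚ.≤-trans (ℚ.≤-reflexive (sym (halve-0 n))) (halve-mono n 0≤q)
  where
  halve-0 : ∀ n → halve n 0ℚ ≡ 0ℚ
  halve-0 zero    = refl
  halve-0 (suc n) = trans (cong (½ ℚ.*_) (halve-0 n)) refl

0<halve : ∀ n {q} → 0ℚ ℚ.< q → 0ℚ ℚ.< halve n q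
0<halve zero    0<q = 0<q
0<halve (suc n) {q} 0<q = subst (ℚ._< ½ ℚ.* halve n q) (ℚ.*-zeroʳ ½) (ℚ.*-monoʳ-<-pos ½ (0<halve n 0<q))

2^*halve : ∀ n q → ν (2 ℕ.^ n) ℚ.* halve n q ≡ q
2^*halve zero    q = trans (cong (ℚ._* q) (ι≡/1 (+ 1))) (ℚ.*-identityˡ q)
2^*halve (suc n) q = begin
  ν (2 ℕ.* 2 ℕ.^ n) ℚ.* (½ ℚ.* halve n q)       ≡⟨ cong (ℚ._* (½ ℚ.* halve n q)) (trans (ν-* 2 (2 ℕ.^ n)) (cong (ℚ._* ν (2 ℕ.^ n)) (ι≡/1 (+ 2)))) ⟩
  + 2 ℚ./ 1 ℚ.* ν (2 ℕ.^ n) ℚ.* (½ ℚ.* halve n q)  ≡⟨ rearrange (ν (2 ℕ.^ n)) (halve n q) ⟩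
  ν (2 ℕ.^ n) ℚ.* halve n q                     ≡⟨ 2^*halve n q ⟩
  q                                             ∎
  where
  open ≡-Reasoning
  rearrange : ∀ x y → + 2 ℚ./ 1 ℚ.* x ℚ.* (½ ℚ.* y) ≡ x ℚ.* y
  rearrange = solve 2 (λ x y → con (+ 2 ℚ./ 1) :* x :* (con ½ :* y) := x :* y) refl

n≤2^n : ∀ n → n ℕ.≤ 2 ℕ.^ n
n≤2^n zero    = ℕ.z≤n
n≤2^n (suc n) = begin
  1 ℕ.+ n                        ≤⟨ ℕ.+-mono-≤ (ℕ.m^n>0 2 n) (n≤2^n n) ⟩
  2 ℕ.^ n ℕ.+ 2 ℕ.^ n            ≡⟨ cong (2 ℕ.^ n ℕ.+_) (ℕ.+-identityʳ (2 ℕ.^ n)) ⟨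
  2 ℕ.^ suc n                    ∎
  where open ℕ.≤-Reasoning

record Interval : Set where
  field
    lo hi : ℚ
    lo≤hi : lo ℚ.≤ hi

open Interval public

width : Interval → ℚ
width I = hi I ℚ.- lo I

0≤width : ∀ I → 0ℚ ℚ.≤ width I
0≤width I = subst (ℚ._≤ width I) (ℚ.+-inverseʳ (lo I)) (ℚ.+-monoˡ-≤ (ℚ.- lo I) (lo≤hi I))

total : List Interval → ℚ
total []       = 0ℚ
total (I ∷ Is) = width I ℚ.+ total Is

0≤total : ∀ Is → 0ℚ ℚ.≤ total Is
0≤total []       = ℚ.≤-refl
0≤total (I ∷ Is) = ℚ.+-mono-≤ (0≤width I) (0≤total Is)

total-map : ∀ {A : Set} {w} (f : A → Interval) → (∀ x → width (f x) ≡ w) →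
  ∀ xs → total (List.map f xs) ≡ ν (length xs) ℚ.* w
total-map {w = w} f width≡w []       = sym (trans (cong (ℚ._* w) (ι≡/1 (+ 0))) (ℚ.*-zeroˡ w))
total-map {w = w} f width≡w (x ∷ xs) = begin
  width (f x) ℚ.+ total (List.map f xs)    ≡⟨ cong₂ ℚ._+_ (width≡w x) (total-map f width≡w xs) ⟩
  w ℚ.+ ν (length xs) ℚ.* w                ≡⟨ rearrange w (ν (length xs)) ⟩
  (1ℚ ℚ.+ ν (length xs)) ℚ.* w             ≡⟨ cong (ℚ._* w) (ν-suc (length xs)) ⟨
  ν (length (x ∷ xs)) ℚ.* w                ∎
  where
  open ≡-Reasoning
  rearrange : ∀ w n → w ℚ.+ n ℚ.* w ≡ (1ℚ ℚ.+ n) ℚ.* w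
  rearrange = solve 2 (λ w n → w :+ n :* w := (con 1ℚ :+ n) :* w) refl

_inside_ : ℝ → Interval → Set
x inside I = (fromℚ (lo I) < x) × (x < fromℚ (hi I))

-- Jordan content zero: the covers are finite and, the endpoints being rational, so are their
-- lengths. Countable unions of such sets are null by `coverable-⋃⇒null`.
Coverable : Pred ℝ 0ℓ → Set
Coverable P = ∀ η → 0ℚ ℚ.< η →
  ∃[ Is ] total Is ℚ.≤ η × (∀ x → P x → Any (x inside_) Is)

point : Interval
point = record { lo = 0ℚ ; hi = 0ℚ ; lo≤hi = ℚ.≤-refl }

-- The degenerate interval emitted at the end of each list makes the recursion
-- on the index structural even when some of the lists are empty.
enumerate : (ℕ → List Interval) → List Interval → ℕ → Interval
enumerate L []       zero    = point
enumerate L []       (suc i) = enumerate (L ∘ suc) (L 0) i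
enumerate L (I ∷ Is) zero    = I
enumerate L (I ∷ Is) (suc i) = enumerate L Is i

∑ : ℕ → (ℕ → ℚ) → ℚ
∑ zero    x = 0ℚ
∑ (suc k) x = ∑ k x ℚ.+ x k

-- Needed because `∑` recurses on its last term, whereas `enumerate` produces the first interval
-- first.
∑-suc : ∀ k x → ∑ (suc k) x ≡ x 0 ℚ.+ ∑ k (x ∘ suc)
∑-suc zero    x = ℚ.+-comm 0ℚ (x 0)
∑-suc (suc k) x = trans (cong (ℚ._+ x (suc k)) (∑-suc k x)) (ℚ.+-assoc (x 0) (∑ k (x ∘ suc)) (x (suc k)))

-- `Is` is the rest of the current list, and `η` the budget for all the lists in `L`. When a list
-- runs out, half of the budget pays for `L 0`, and the other half for `L ∘ suc`, by `small′`.
∑-enumerate : ∀ L Is η → 0ℚ ℚ.≤ η → (∀ T → total (L T) ℚ.≤ halve (suc T) η) →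
  ∀ k → ∑ k (width ∘ enumerate L Is) ℚ.≤ total Is ℚ.+ η
∑-enumerate L Is η 0≤η small zero = ℚ.+-mono-≤ (0≤total Is) 0≤η
∑-enumerate L (I ∷ Is) η 0≤η small (suc k) = begin
  ∑ (suc k) (width ∘ enumerate L (I ∷ Is))             ≡⟨ ∑-suc k (width ∘ enumerate L (I ∷ Is)) ⟩
  width I ℚ.+ ∑ k (width ∘ enumerate L Is)             ≤⟨ ℚ.+-monoʳ-≤ (width I) (∑-enumerate L Is η 0≤η small k) ⟩
  width I ℚ.+ (total Is ℚ.+ η)                         ≡⟨ ℚ.+-assoc (width I) (total Is) η ⟨
  width I ℚ.+ total Is ℚ.+ η                           ∎
  where open ℚ.≤-Reasoning
∑-enumerate L [] η 0≤η small (suc k) = begin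
  ∑ (suc k) (width ∘ enumerate L [])                   ≡⟨ ∑-suc k (width ∘ enumerate L []) ⟩
  0ℚ ℚ.+ ∑ k (width ∘ enumerate (L ∘ suc) (L 0))       ≤⟨ ℚ.+-monoʳ-≤ 0ℚ (∑-enumerate (L ∘ suc) (L 0) (½ ℚ.* η) (0≤halve 1 0≤η) small′ k) ⟩
  0ℚ ℚ.+ (total (L 0) ℚ.+ ½ ℚ.* η)                     ≤⟨ ℚ.+-monoʳ-≤ 0ℚ (ℚ.+-monoˡ-≤ (½ ℚ.* η) (small 0)) ⟩
  0ℚ ℚ.+ (½ ℚ.* η ℚ.+ ½ ℚ.* η)                         ≡⟨ cong (0ℚ ℚ.+_) (½+½ η) ⟩
  0ℚ ℚ.+ η                                             ∎
  where
  open ℚ.≤-Reasoning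
  small′ : ∀ T → total (L (suc T)) ℚ.≤ halve (suc T) (½ ℚ.* η)
  small′ T = subst (total (L (suc T)) ℚ.≤_) (cong (½ ℚ.*_) (*-halve ½ T η)) (small (suc T))

enumerate-here : ∀ {P : Pred Interval 0ℓ} L {Is} → Any P Is → ∃[ i ] P (enumerate L Is i)
enumerate-here L (here p)  = 0 , p
enumerate-here L (there p) with enumerate-here L p
... | i , p′ = suc i , p′

enumerate-later : ∀ {P : Pred Interval 0ℓ} L Is T → Any P (L T) → ∃[ i ] P (enumerate L Is i)
enumerate-later L (I ∷ Is) T p with enumerate-later L Is T p
... | i , p′ = suc i , p′
enumerate-later L [] zero p with enumerate-here (L ∘ suc) p
... | i , p′ = suc i , p′
enumerate-later L [] (suc T) p with enumerate-later (L ∘ suc) (L 0) T p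
... | i , p′ = suc i , p′

seq-sum : ∀ k I n →
  seq (sum k (λ i → fromℚ (hi (I i)) - fromℚ (lo (I i)))) n ≡ ∑ k (width ∘ I)
seq-sum zero    I n = refl
seq-sum (suc k) I n = cong (ℚ._+ width (I k)) (seq-sum k I n)

-- The witness `e` of `0ℝ < ε` is a positive rational that the terms of `ε` eventually reach or
-- exceed; the set `P T` gets the share e / 2 ^ (T + 1) of it.
coverable-⋃⇒null : ∀ {E : Pred ℝ 0ℓ} (P : ℕ → Pred ℝ 0ℓ) → (∀ T → Coverable (P T)) →
  (∀ x → E x → ∃[ T ] P T x) → Null E
coverable-⋃⇒null P coverable E⊆⋃P ε (e , 0<e , N , e≤ε) =
  (λ i → fromℚ (lo (I i))) , (λ i → fromℚ (hi (I i))) ,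
  (λ i δ 0<δ → 0 , λ n _ → ℚ.≤-trans (ℚ.≤-reflexive (sym (ℚ.+-identityʳ (lo (I i))))) (ℚ.+-mono-≤ (lo≤hi (I i)) (ℚ.<⇒≤ 0<δ))) ,
  (λ k δ 0<δ → N , λ n N≤n → begin
    seq (sum k (λ i → fromℚ (hi (I i)) - fromℚ (lo (I i)))) n    ≡⟨ seq-sum k I n ⟩
    ∑ k (width ∘ I)                                              ≤⟨ ∑-enumerate L [] e (ℚ.<⇒≤ 0<e) (λ T → proj₁ (proj₂ (coverable T _ (0<halve (suc T) 0<e)))) k ⟩
    0ℚ ℚ.+ e                                                     ≤⟨ e≤ε n N≤n ⟩
    seq ε n                                                      ≡⟨ ℚ.+-identityʳ (seq ε n) ⟨
    seq ε n ℚ.+ 0ℚ                                               ≤⟨ ℚ.+-monoʳ-≤ (seq ε n) (ℚ.<⇒≤ 0<δ) ⟩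
    seq ε n ℚ.+ δ                                                ∎) ,
  (λ x x∈E → let T , x∈P = E⊆⋃P x x∈E in
    enumerate-later L [] T (proj₂ (proj₂ (coverable T _ (0<halve (suc T) 0<e))) x x∈P))
  where
  open ℚ.≤-Reasoning
  L : ℕ → List Interval
  L T = proj₁ (coverable T (halve (suc T) e) (0<halve (suc T) 0<e))
  I : ℕ → Interval
  I = enumerate L []

-- Nested integer approximations

-- If x a and x a′ are within less than C of 8 C t and 8 C t′ respectively, then
-- 8 a t′ and 8 a′ t differ by less than a + a′; window t lists these t′.
module _ (a a′ : ℕ) .{{_ : ℕ.NonZero a}} where
  private instance
    8a≢0 : ℕ.NonZero (8 ℕ.* a)
    8a≢0 = ℕ.m*n≢0 8 a
    4a≢0 : ℕ.NonZero (4 ℕ.* a)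
    4a≢0 = ℕ.m*n≢0 4 a

  lower : ℤ → ℤ
  lower t = + (8 ℕ.* a′) ℤ.* t ℤ.- + (a ℕ.+ a′)

  first : ℤ → ℤ
  first t = ℤ.suc (lower t ℤ./ℕ (8 ℕ.* a))

  -- The t′ allowed for one t fill an open interval of length (a + a′) / (4 a), so this many
  -- consecutive integers from `first t` on include them all.
  count : ℕ
  count = suc ((a ℕ.+ a′) ℕ./ (4 ℕ.* a))

  window : ℤ → List ℤ
  window t = List.applyUpTo (λ i → first t ℤ.+ + i) count

  length-window : ∀ t → length (window t) ≡ count
  length-window t = List.length-applyUpTo (λ i → first t ℤ.+ + i) count

  count-large : 2 ℕ.* (a ℕ.+ a′) ℕ.≤ count ℕ.* (8 ℕ.* a)
  count-large = begin
    2 ℕ.* (a ℕ.+ a′)               ≤⟨ ℕ.*-monoʳ-≤ 2 (ℕ.<⇒≤ a+a′<) ⟩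
    2 ℕ.* (count ℕ.* (4 ℕ.* a))    ≡⟨ solve′ count a ⟩
    count ℕ.* (8 ℕ.* a)            ∎
    where
    open ℕ.≤-Reasoning
    a+a′< : a ℕ.+ a′ ℕ.< count ℕ.* (4 ℕ.* a)
    a+a′< = begin-strict
      a ℕ.+ a′                                                      ≡⟨ ℕ.m≡m%n+[m/n]*n (a ℕ.+ a′) (4 ℕ.* a) ⟩
      (a ℕ.+ a′) ℕ.% (4 ℕ.* a) ℕ.+ (a ℕ.+ a′) ℕ./ (4 ℕ.* a) ℕ.* (4 ℕ.* a)  <⟨ ℕ.+-monoˡ-< _ (ℕ.m%n<n (a ℕ.+ a′) (4 ℕ.* a)) ⟩
      count ℕ.* (4 ℕ.* a)                                           ∎
    solve′ : ∀ x y → 2 ℕ.* (x ℕ.* (4 ℕ.* y)) ≡ x ℕ.* (8 ℕ.* y)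
    solve′ = ℕ.solve-∀

  -- The halving step: rounding up costs at most 4 a, and 5 a + a′ ≤ 2 a′. A centre thus has at most
  -- a′ / (2 a) successors, while lengths shrink by the factor a / a′.
  count-small : 5 ℕ.* a ℕ.≤ a′ → count ℕ.* (2 ℕ.* a) ℕ.≤ a′
  count-small 5a≤a′ = ℕ.*-cancelˡ-≤ 2 (begin
    2 ℕ.* (count ℕ.* (2 ℕ.* a))                           ≡⟨ rearrange₁ q a ⟩
    q ℕ.* (4 ℕ.* a) ℕ.+ 4 ℕ.* a                           ≤⟨ ℕ.+-monoˡ-≤ (4 ℕ.* a) (ℕ.m/n*n≤m (a ℕ.+ a′) (4 ℕ.* a)) ⟩
    (a ℕ.+ a′) ℕ.+ 4 ℕ.* a                                ≡⟨ rearrange₂ a a′ ⟩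
    5 ℕ.* a ℕ.+ a′                                        ≤⟨ ℕ.+-monoˡ-≤ a′ 5a≤a′ ⟩
    a′ ℕ.+ a′                                             ≡⟨ cong (a′ ℕ.+_) (ℕ.+-identityʳ a′) ⟨
    2 ℕ.* a′                                              ∎)
    where
    open ℕ.≤-Reasoning
    q = (a ℕ.+ a′) ℕ./ (4 ℕ.* a)
    rearrange₁ : ∀ x y → 2 ℕ.* ((1 ℕ.+ x) ℕ.* (2 ℕ.* y)) ≡ x ℕ.* (4 ℕ.* y) ℕ.+ 4 ℕ.* y
    rearrange₁ = ℕ.solve-∀
    rearrange₂ : ∀ x y → (x ℕ.+ y) ℕ.+ 4 ℕ.* x ≡ 5 ℕ.* x ℕ.+ y
    rearrange₂ = ℕ.solve-∀

  -- The lower bound puts t′ at or after `first t`. Were its index in the window at least `count`,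
  -- then `count-large` would push 8 a t′ past the upper bound.
  window-complete : ∀ t t′ →
    lower t ℤ.< t′ ℤ.* + (8 ℕ.* a) →
    t′ ℤ.* + (8 ℕ.* a) ℤ.< lower t ℤ.+ + (2 ℕ.* (a ℕ.+ a′)) →
    t′ ∈ window t
  window-complete t t′ N<t′d t′d<N+2s =
    subst (_∈ window t) (trans (cong (λ j → first t ℤ.+ j) i≡) (cancel (first t) t′))
      (∈.∈-applyUpTo⁺ (λ i → first t ℤ.+ + i) (ℕ.≰⇒> λ count≤i → ℤ.<-irrefl refl (contra count≤i)))
    where
    N = lower t
    d = 8 ℕ.* a
    i = ℤ.∣ t′ ℤ.- first t ∣
    open ℤ.≤-Reasoning
    first≤t′ : first t ℤ.≤ t′
    first≤t′ = ℤ.i<j⇒suc[i]≤j (ℤ.*-cancelʳ-<-nonNeg {N ℤ./ℕ d} {t′} (+ d) (begin-strict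
      (N ℤ./ℕ d) ℤ.* + d   ≤⟨ ℤ.[n/ℕd]*d≤n N d ⟩
      N                    <⟨ N<t′d ⟩
      t′ ℤ.* + d           ∎))
    i≡ : + i ≡ t′ ℤ.- first t
    i≡ = ℤ.0≤i⇒+∣i∣≡i (ℤ.i≤j⇒0≤j-i first≤t′)
    cancel : ∀ x y → x ℤ.+ (y ℤ.- x) ≡ y
    cancel = ℤ.solve-∀
    split : ∀ x y z → x ℤ.* z ℤ.+ (y ℤ.- x) ℤ.* z ≡ y ℤ.* z
    split = ℤ.solve-∀
    contra : count ℕ.≤ i → t′ ℤ.* + d ℤ.< t′ ℤ.* + d
    contra count≤i = begin-strict
      t′ ℤ.* + d                                           <⟨ t′d<N+2s ⟩
      N ℤ.+ + (2 ℕ.* (a ℕ.+ a′))                           ≤⟨ ℤ.+-mono-≤ (ℤ.<⇒≤ (ℤ.n<s[n/ℕd]*d N d)) (ℤ.+≤+ (ℕ.≤-trans count-large (ℕ.*-monoˡ-≤ d count≤i))) ⟩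
      first t ℤ.* + d ℤ.+ + (i ℕ.* d)                      ≡⟨ cong (λ j → first t ℤ.* + d ℤ.+ j) (ℤ.pos-* i d) ⟩
      first t ℤ.* + d ℤ.+ + i ℤ.* + d                      ≡⟨ cong (λ j → first t ℤ.* + d ℤ.+ j ℤ.* + d) i≡ ⟩
      first t ℤ.* + d ℤ.+ (t′ ℤ.- first t) ℤ.* + d         ≡⟨ split (first t) t′ (+ d) ⟩
      t′ ℤ.* + d                                           ∎

length-concatMap : ∀ {A B : Set} (f : A → List B) n → (∀ x → length (f x) ≡ n) →
  ∀ xs → length (List.concatMap f xs) ≡ length xs ℕ.* n
length-concatMap f n |f|≡n []       = refl
length-concatMap f n |f|≡n (x ∷ xs) = begin
  length (f x ++ List.concatMap f xs)           ≡⟨ List.length-++ (f x) ⟩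
  length (f x) ℕ.+ length (List.concatMap f xs) ≡⟨ cong₂ ℕ._+_ (|f|≡n x) (length-concatMap f n |f|≡n xs) ⟩
  n ℕ.+ length xs ℕ.* n                         ∎
  where open ≡-Reasoning

-- Refinement along a growing sequence of scales

module Refinement
  (c : ℕ) (b : ℕ → ℤ) (unbounded : ∀ n → ∃[ j ] n ℕ.≤ ℤ.∣ b j ∣)
  where

  -- The tolerance `c` is below an eighth of the spacing `K`. The surplus of `C` over `c` makes the
  -- integer estimates strict and leaves room for open intervals.
  C K : ℕ
  C = suc c
  K = 8 ℕ.* C

  -- The factor 5 makes (a + a′) / (4 a) + 1, the number of t′ for each t, at most a′ / (2 a).
  scale : ℕ → ℕ
  scale zero    = 1
  scale (suc s) = ℤ.∣ b (proj₁ (unbounded (5 ℕ.* scale s))) ∣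

  scale-grows : ∀ s → 5 ℕ.* scale s ℕ.≤ scale (suc s)
  scale-grows s = proj₂ (unbounded (5 ℕ.* scale s))

  scale≢0 : ∀ s → ℕ.NonZero (scale s)
  scale≢0 zero    = _
  scale≢0 (suc s) = ℕ.>-nonZero (ℕ.<-≤-trans (ℕ.>-nonZero⁻¹ _ {{ℕ.m*n≢0 5 (scale s) {{_}} {{scale≢0 s}}}}) (scale-grows s))

  centres : ℕ → List ℤ
  centres zero    = + 0 ∷ []
  centres (suc s) = List.concatMap (window (scale s) (scale (suc s)) {{scale≢0 s}}) (centres s)

  -- By `count-small`, the number of centres grows at each stage by at most half the factor by which
  -- the scale grows.
  centres-sparse : ∀ s → length (centres s) ℕ.* 2 ℕ.^ s ℕ.≤ scale s
  centres-sparse zero    = ℕ.≤-refl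
  centres-sparse (suc s) = begin
    length (centres (suc s)) ℕ.* 2 ℕ.^ suc s
      ≡⟨ cong (ℕ._* 2 ℕ.^ suc s) (length-concatMap _ m (length-window (scale s) (scale (suc s)) {{scale≢0 s}}) (centres s)) ⟩
    length (centres s) ℕ.* m ℕ.* (2 ℕ.* 2 ℕ.^ s)
      ≡⟨ rearrange (length (centres s)) m (2 ℕ.^ s) ⟩
    m ℕ.* (2 ℕ.* (length (centres s) ℕ.* 2 ℕ.^ s))
      ≤⟨ ℕ.*-monoʳ-≤ m (ℕ.*-monoʳ-≤ 2 (centres-sparse s)) ⟩
    m ℕ.* (2 ℕ.* scale s)
      ≤⟨ count-small (scale s) (scale (suc s)) {{scale≢0 s}} (scale-grows s) ⟩
    scale (suc s) ∎
    where
    open ℕ.≤-Reasoning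
    m = count (scale s) (scale (suc s)) {{scale≢0 s}}
    rearrange : ∀ x y z → x ℕ.* y ℕ.* (2 ℕ.* z) ≡ y ℕ.* (2 ℕ.* (x ℕ.* z))
    rearrange = ℕ.solve-∀

  Near : ℚ → ℕ → ℤ → Set
  Near x a t = ℚ.∣ x ℚ.* ν a ℚ.- ν K ℚ.* ι t ∣ ℚ.≤ ν c

  -- Elimination of x: the number a (x a′ - K t′) - a′ (x a - K t) is C times the left-hand side,
  -- and it is at most c (a + a′), hence less than C (a + a′).
  drift : ∀ {x a a′ t t′} → 0ℚ ℚ.< ν a → Near x a t → Near x a′ t′ →
    ν 8 ℚ.* ν a′ ℚ.* ι t ℚ.- ν 8 ℚ.* ν a ℚ.* ι t′ ℚ.< ν a ℚ.+ ν a′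
  drift {x} {a} {a′} {t} {t′} 0<a near near′ = ℚ.*-cancelˡ-<-nonNeg (ν C) {{ℚ.nonNegative (0≤ν C)}} (begin-strict
    ν C ℚ.* (ν 8 ℚ.* ν a′ ℚ.* ι t ℚ.- ν 8 ℚ.* ν a ℚ.* ι t′)
      ≡⟨ rearrange (ν C) (ν 8) (ν a) (ν a′) (ι t) (ι t′) x ⟩
    ν a ℚ.* (x ℚ.* ν a′ ℚ.- (ν 8 ℚ.* ν C) ℚ.* ι t′) ℚ.+ ν a′ ℚ.* (ℚ.- (x ℚ.* ν a ℚ.- (ν 8 ℚ.* ν C) ℚ.* ι t))
      ≡⟨ cong (λ k → ν a ℚ.* (x ℚ.* ν a′ ℚ.- k ℚ.* ι t′) ℚ.+ ν a′ ℚ.* (ℚ.- (x ℚ.* ν a ℚ.- k ℚ.* ι t))) (ν-* 8 C) ⟨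
    ν a ℚ.* (x ℚ.* ν a′ ℚ.- ν K ℚ.* ι t′) ℚ.+ ν a′ ℚ.* (ℚ.- (x ℚ.* ν a ℚ.- ν K ℚ.* ι t))
      ≤⟨ ℚ.+-mono-≤ (*-monoˡ (ν a) (0≤ν a) (ℚ.≤-trans (p≤∣p∣ _) near′))
                    (*-monoˡ (ν a′) (0≤ν a′) (ℚ.≤-trans (-p≤∣p∣ _) near)) ⟩
    ν a ℚ.* ν c ℚ.+ ν a′ ℚ.* ν c
      ≡⟨ collect (ν a) (ν a′) (ν c) ⟩
    0ℚ ℚ.+ ν c ℚ.* (ν a ℚ.+ ν a′)
      <⟨ ℚ.+-monoˡ-< (ν c ℚ.* (ν a ℚ.+ ν a′)) (ℚ.+-mono-<-≤ 0<a (0≤ν a′)) ⟩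
    (ν a ℚ.+ ν a′) ℚ.+ ν c ℚ.* (ν a ℚ.+ ν a′)
      ≡⟨ factor (ν c) (ν a ℚ.+ ν a′) ⟩
    (1ℚ ℚ.+ ν c) ℚ.* (ν a ℚ.+ ν a′)
      ≡⟨ cong (ℚ._* (ν a ℚ.+ ν a′)) (ν-suc c) ⟨
    ν C ℚ.* (ν a ℚ.+ ν a′) ∎)
    where
    open ℚ.≤-Reasoning
    rearrange : ∀ C e a a′ t t′ x → C ℚ.* (e ℚ.* a′ ℚ.* t ℚ.- e ℚ.* a ℚ.* t′) ≡
      a ℚ.* (x ℚ.* a′ ℚ.- (e ℚ.* C) ℚ.* t′) ℚ.+ a′ ℚ.* (ℚ.- (x ℚ.* a ℚ.- (e ℚ.* C) ℚ.* t))
    rearrange = solve 7 (λ C e a a′ t t′ x → C :* (e :* a′ :* t :- e :* a :* t′) :=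
      a :* (x :* a′ :- (e :* C) :* t′) :+ a′ :* (:- (x :* a :- (e :* C) :* t))) refl
    collect : ∀ a a′ c → a ℚ.* c ℚ.+ a′ ℚ.* c ≡ 0ℚ ℚ.+ c ℚ.* (a ℚ.+ a′)
    collect = solve 3 (λ a a′ c → a :* c :+ a′ :* c := con 0ℚ :+ c :* (a :+ a′)) refl
    factor : ∀ c s → s ℚ.+ c ℚ.* s ≡ (1ℚ ℚ.+ c) ℚ.* s
    factor = solve 2 (λ c s → s :+ c :* s := (con 1ℚ :+ c) :* s) refl

  drift-ℤ : ∀ {x a a′ t t′} .{{_ : ℕ.NonZero a}} → Near x a t → Near x a′ t′ →
    + (8 ℕ.* a′) ℤ.* t ℤ.- t′ ℤ.* + (8 ℕ.* a) ℤ.< + (a ℕ.+ a′)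
  drift-ℤ {x} {a} {a′} {t} {t′} near near′ = ι-cancel-< (begin-strict
    ι (+ (8 ℕ.* a′) ℤ.* t ℤ.- t′ ℤ.* + (8 ℕ.* a))
      ≡⟨ ι-minus (+ (8 ℕ.* a′) ℤ.* t) (t′ ℤ.* + (8 ℕ.* a)) ⟩
    ι (+ (8 ℕ.* a′) ℤ.* t) ℚ.- ι (t′ ℤ.* + (8 ℕ.* a))
      ≡⟨ cong₂ ℚ._-_ (trans (ι-* (+ (8 ℕ.* a′)) t) (cong (ℚ._* ι t) (ν-* 8 a′)))
                     (trans (ι-* t′ (+ (8 ℕ.* a))) (trans (ℚ.*-comm (ι t′) (ν (8 ℕ.* a))) (cong (ℚ._* ι t′) (ν-* 8 a)))) ⟩
    ν 8 ℚ.* ν a′ ℚ.* ι t ℚ.- ν 8 ℚ.* ν a ℚ.* ι t′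
      <⟨ drift {x} {a} {a′} {t} {t′} (0<ν a) near near′ ⟩
    ν a ℚ.+ ν a′
      ≡⟨ ι-+ (+ a) (+ a′) ⟨
    ν (a ℕ.+ a′) ∎)
    where open ℚ.≤-Reasoning

  -- `drift-ℤ` yields the lower end of the range for 8 a t′; the same estimate with the two
  -- constraints exchanged yields the upper end.
  near⇒window : ∀ {x a a′ t t′} .{{_ : ℕ.NonZero a}} .{{_ : ℕ.NonZero a′}} →
    Near x a t → Near x a′ t′ → t′ ∈ window a a′ t
  near⇒window {x} {a} {a′} {t} {t′} near near′ = window-complete a a′ t t′
    (begin-strict
      p ℤ.- s                          ≡⟨ shift₁ p q s ⟩
      q ℤ.+ (p ℤ.- q) ℤ.- s            <⟨ ℤ.+-monoˡ-< (ℤ.- s) (ℤ.+-monoʳ-< q (drift-ℤ {x} {a} {a′} {t} {t′} near near′)) ⟩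
      q ℤ.+ s ℤ.- s                    ≡⟨ cancel q s ⟩
      q                                ∎)
    (begin-strict
      q                                ≡⟨ shift₂ p q s ⟩
      p ℤ.- s ℤ.+ (s ℤ.+ (q ℤ.- p))    ≡⟨ cong (λ r → p ℤ.- s ℤ.+ (s ℤ.+ r)) (cong₂ ℤ._-_ (ℤ.*-comm t′ (+ (8 ℕ.* a))) (ℤ.*-comm (+ (8 ℕ.* a′)) t)) ⟩
      p ℤ.- s ℤ.+ (s ℤ.+ (+ (8 ℕ.* a) ℤ.* t′ ℤ.- t ℤ.* + (8 ℕ.* a′)))
                                       <⟨ ℤ.+-monoʳ-< (p ℤ.- s) (ℤ.+-monoʳ-< s (drift-ℤ {x} {a′} {a} {t′} {t} near′ near)) ⟩
      p ℤ.- s ℤ.+ (s ℤ.+ + (a′ ℕ.+ a)) ≡⟨ cong (λ n → p ℤ.- s ℤ.+ (s ℤ.+ + n)) (ℕ.+-comm a′ a) ⟩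
      p ℤ.- s ℤ.+ + ((a ℕ.+ a′) ℕ.+ (a ℕ.+ a′))
                                       ≡⟨ cong (λ n → p ℤ.- s ℤ.+ + ((a ℕ.+ a′) ℕ.+ n)) (ℕ.+-identityʳ (a ℕ.+ a′)) ⟨
      p ℤ.- s ℤ.+ + (2 ℕ.* (a ℕ.+ a′)) ∎)
    where
    open ℤ.≤-Reasoning
    p q s : ℤ
    p = + (8 ℕ.* a′) ℤ.* t
    q = t′ ℤ.* + (8 ℕ.* a)
    s = + (a ℕ.+ a′)
    shift₁ : ∀ p q s → p ℤ.- s ≡ q ℤ.+ (p ℤ.- q) ℤ.- s
    shift₁ = ℤ.solve-∀
    cancel : ∀ q s → q ℤ.+ s ℤ.- s ≡ q
    cancel = ℤ.solve-∀
    shift₂ : ∀ p q s → q ≡ p ℤ.- s ℤ.+ (s ℤ.+ (q ℤ.- p))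
    shift₂ = ℤ.solve-∀

  -- The integer t′ depends only on z and t, so that it serves along a whole Cauchy sequence.
  near-∣∣ : ∀ z t → ∃[ t′ ] ∀ x → ℚ.∣ x ℚ.* ι z ℚ.- ν K ℚ.* ι t ∣ ℚ.≤ ν c → Near x ℤ.∣ z ∣ t′
  near-∣∣ (+ n)    t = t , λ _ near → near
  near-∣∣ -[1+ n ] t = ℤ.- t , λ x near → subst (ℚ._≤ ν c) (begin
    ℚ.∣ x ℚ.* ι -[1+ n ] ℚ.- ν K ℚ.* ι t ∣                  ≡⟨ ℚ.∣-p∣≡∣p∣ _ ⟨
    ℚ.∣ ℚ.- (x ℚ.* ι -[1+ n ] ℚ.- ν K ℚ.* ι t) ∣            ≡⟨ cong (λ y → ℚ.∣ ℚ.- (x ℚ.* y ℚ.- ν K ℚ.* ι t) ∣) (ι-neg (+ suc n)) ⟩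
    ℚ.∣ ℚ.- (x ℚ.* (ℚ.- ν (suc n)) ℚ.- ν K ℚ.* ι t) ∣       ≡⟨ cong ℚ.∣_∣ (rearrange x (ν (suc n)) (ν K) (ι t)) ⟩
    ℚ.∣ x ℚ.* ν (suc n) ℚ.- ν K ℚ.* (ℚ.- ι t) ∣             ≡⟨ cong (λ y → ℚ.∣ x ℚ.* ν (suc n) ℚ.- ν K ℚ.* y ∣) (ι-neg t) ⟨
    ℚ.∣ x ℚ.* ν (suc n) ℚ.- ν K ℚ.* ι (ℤ.- t) ∣             ∎) near
    where
    open ≡-Reasoning
    rearrange : ∀ x n k t → ℚ.- (x ℚ.* (ℚ.- n) ℚ.- k ℚ.* t) ≡ x ℚ.* n ℚ.- k ℚ.* (ℚ.- t)
    rearrange = solve 4 (λ x n k t → :- (x :* (:- n) :- k :* t) := x :* n :- k :* (:- t)) refl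

  near⇒centre : ∀ s t′ x t → t ∈ centres s → Near x (scale s) t → Near x (scale (suc s)) t′ →
    t′ ∈ centres (suc s)
  near⇒centre s t′ x t t∈ near near′ =
    ∈.∈-concatMap⁺ (window (scale s) (scale (suc s)) {{scale≢0 s}}) (Any.map (λ { refl →
      near⇒window {x} {scale s} {scale (suc s)} {t} {t′} {{scale≢0 s}} {{scale≢0 (suc s)}} near near′ }) t∈)

  -- Stated for tails of the rational sequence, so that the refinement is rational arithmetic. The
  -- integer `t` is chosen before the tail and serves all of its terms.
  Trapped : ℝ → Set
  Trapped α = Eventually (λ n → ℚ.∣ seq α n ∣ ℚ.≤ ν c) ×
    (∀ j → ∃[ t ] Eventually (λ n → ℚ.∣ seq α n ℚ.* ι (b j) ℚ.- ν K ℚ.* ι t ∣ ℚ.≤ ν c))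

  trapped⇒near : ∀ α → Trapped α → ∀ s →
    ∃[ t ] t ∈ centres s × Eventually (λ n → Near (seq α n) (scale s) t)
  -- The bound on |α| is itself the constraint at scale 1, with centre 0.
  trapped⇒near α (bounded , _) zero = + 0 , here refl ,
    Eventually-map (λ n → subst (λ x → ℚ.∣ x ∣ ℚ.≤ ν c) (trans (rearrange (seq α n) (ν K))
      (cong₂ (λ y z → seq α n ℚ.* y ℚ.- ν K ℚ.* z) (sym (ι≡/1 (+ 1))) (sym (ι≡/1 (+ 0)))))) bounded
    where
    rearrange : ∀ x k → x ≡ x ℚ.* 1ℚ ℚ.- k ℚ.* 0ℚ
    rearrange = solve 2 (λ x k → x := x :* con 1ℚ :- k :* con 0ℚ) refl
  trapped⇒near α trapped (suc s) =
    let t , t∈ , near   = trapped⇒near α trapped s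
        j               = proj₁ (unbounded (5 ℕ.* scale s))
        u , close       = proj₂ trapped j
        t′ , close⇒near = near-∣∣ (b j) u
        near′           = Eventually-map (λ n → close⇒near (seq α n)) close
        -- Membership of t′ among the centres does not mention the sequence, so a single index at
        -- which both constraints hold is enough.
        N , both        = Eventually-× near near′
    in t′ , near⇒centre s t′ (seq α N) t t∈ (proj₁ (both N ℕ.≤-refl)) (proj₂ (both N ℕ.≤-refl)) , near′

  module _ (s : ℕ) where
    private
      a = scale s
      instance
        a≢0 : ℕ.NonZero a
        a≢0 = scale≢0 s

    -- The radius is C / a rather than c / a: the surplus 1 / a on either side is the positive
    -- rational gap that `_<_` on real numbers demands.
    interval : ℤ → Interval
    interval t = record
      { lo    = (ν K ℚ.* ι t ℚ.- ν C) ℚ.* ρ a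
      ; hi    = (ν K ℚ.* ι t ℚ.+ ν C) ℚ.* ρ a
      ; lo≤hi = *-monoʳ (ρ a) (ℚ.<⇒≤ (0<ρ a)) (ℚ.+-monoʳ-≤ (ν K ℚ.* ι t)
                  (ℚ.≤-trans (ℚ.neg-antimono-≤ (0≤ν C)) (0≤ν C)))
      }

    width-interval : ∀ t → width (interval t) ≡ (ν C ℚ.+ ν C) ℚ.* ρ a
    width-interval t = rearrange (ν K ℚ.* ι t) (ν C) (ρ a)
      where
      rearrange : ∀ x c r → (x ℚ.+ c) ℚ.* r ℚ.- (x ℚ.- c) ℚ.* r ≡ (c ℚ.+ c) ℚ.* r
      rearrange = solve 3 (λ x c r → (x :+ c) :* r :- (x :- c) :* r := (c :+ c) :* r) refl

    cancel-ρ : ∀ x → x ≡ (x ℚ.* ν a) ℚ.* ρ a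
    cancel-ρ x = sym (trans (ℚ.*-assoc x (ν a) (ρ a)) (trans (cong (x ℚ.*_) (ν*ρ a)) (ℚ.*-identityʳ x)))

    near⇒<hi : ∀ {x t} → Near x a t → x ℚ.+ ρ a ℚ.≤ hi (interval t)
    near⇒<hi {x} {t} near = begin
      x ℚ.+ ρ a                                      ≡⟨ cong (ℚ._+ ρ a) (cancel-ρ x) ⟩
      x ℚ.* ν a ℚ.* ρ a ℚ.+ ρ a                      ≡⟨ rearrange (x ℚ.* ν a) (ν K ℚ.* ι t) (ρ a) ⟩
      (ν K ℚ.* ι t ℚ.+ (1ℚ ℚ.+ (x ℚ.* ν a ℚ.- ν K ℚ.* ι t))) ℚ.* ρ a
        ≤⟨ *-monoʳ (ρ a) (ℚ.<⇒≤ (0<ρ a)) (ℚ.+-monoʳ-≤ (ν K ℚ.* ι t) (ℚ.+-monoʳ-≤ 1ℚ (ℚ.≤-trans (p≤∣p∣ _) near))) ⟩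
      (ν K ℚ.* ι t ℚ.+ (1ℚ ℚ.+ ν c)) ℚ.* ρ a         ≡⟨ cong (λ y → (ν K ℚ.* ι t ℚ.+ y) ℚ.* ρ a) (ν-suc c) ⟨
      (ν K ℚ.* ι t ℚ.+ ν C) ℚ.* ρ a                  ∎
      where
      open ℚ.≤-Reasoning
      rearrange : ∀ y z r → y ℚ.* r ℚ.+ r ≡ (z ℚ.+ (1ℚ ℚ.+ (y ℚ.- z))) ℚ.* r
      rearrange = solve 3 (λ y z r → y :* r :+ r := (z :+ (con 1ℚ :+ (y :- z))) :* r) refl

    near⇒lo< : ∀ {x t} → Near x a t → lo (interval t) ℚ.+ ρ a ℚ.≤ x
    near⇒lo< {x} {t} near = begin
      (ν K ℚ.* ι t ℚ.- ν C) ℚ.* ρ a ℚ.+ ρ a          ≡⟨ cong (λ y → (ν K ℚ.* ι t ℚ.- y) ℚ.* ρ a ℚ.+ ρ a) (ν-suc c) ⟩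
      (ν K ℚ.* ι t ℚ.- (1ℚ ℚ.+ ν c)) ℚ.* ρ a ℚ.+ ρ a ≡⟨ rearrange₁ (ν K ℚ.* ι t) (ν c) (ρ a) ⟩
      (ν K ℚ.* ι t ℚ.- ν c) ℚ.* ρ a
        ≤⟨ *-monoʳ (ρ a) (ℚ.<⇒≤ (0<ρ a)) (ℚ.+-monoʳ-≤ (ν K ℚ.* ι t) (ℚ.neg-antimono-≤ (ℚ.≤-trans (-p≤∣p∣ _) near))) ⟩
      (ν K ℚ.* ι t ℚ.- (ℚ.- (x ℚ.* ν a ℚ.- ν K ℚ.* ι t))) ℚ.* ρ a
                                                     ≡⟨ cong (ℚ._* ρ a) (rearrange₂ (x ℚ.* ν a) (ν K ℚ.* ι t)) ⟩
      x ℚ.* ν a ℚ.* ρ a                              ≡⟨ cancel-ρ x ⟨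
      x                                              ∎
      where
      open ℚ.≤-Reasoning
      rearrange₁ : ∀ z c r → (z ℚ.- (1ℚ ℚ.+ c)) ℚ.* r ℚ.+ r ≡ (z ℚ.- c) ℚ.* r
      rearrange₁ = solve 3 (λ z c r → (z :- (con 1ℚ :+ c)) :* r :+ r := (z :- c) :* r) refl
      rearrange₂ : ∀ y z → z ℚ.- (ℚ.- (y ℚ.- z)) ≡ y
      rearrange₂ = solve 2 (λ y z → z :- (:- (y :- z)) := y) refl

    intervals : List Interval
    intervals = List.map interval (centres s)

    -- Each interval has length 2 C / a, and by `centres-sparse` there are at most a / 2 ^ s of
    -- them.
    total-intervals : total intervals ℚ.≤ halve s (ν C ℚ.+ ν C)
    total-intervals = begin
      total intervals                              ≡⟨ total-map interval width-interval (centres s) ⟩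
      ν l ℚ.* w                                    ≡⟨ cong (ν l ℚ.*_) (2^*halve s w) ⟨
      ν l ℚ.* (ν (2 ℕ.^ s) ℚ.* halve s w)          ≡⟨ ℚ.*-assoc (ν l) (ν (2 ℕ.^ s)) (halve s w) ⟨
      ν l ℚ.* ν (2 ℕ.^ s) ℚ.* halve s w            ≡⟨ cong (ℚ._* halve s w) (ν-* l (2 ℕ.^ s)) ⟨
      ν (l ℕ.* 2 ℕ.^ s) ℚ.* halve s w              ≤⟨ *-monoʳ (halve s w) (0≤halve s 0≤w) (ν-mono (centres-sparse s)) ⟩
      ν a ℚ.* halve s w                            ≡⟨ *-halve (ν a) s w ⟩
      halve s (ν a ℚ.* w)                          ≡⟨ cong (halve s) (rearrange (ν a) (ν C ℚ.+ ν C) (ρ a)) ⟩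
      halve s ((ν C ℚ.+ ν C) ℚ.* ν a ℚ.* ρ a)      ≡⟨ cong (halve s) (cancel-ρ (ν C ℚ.+ ν C)) ⟨
      halve s (ν C ℚ.+ ν C)                        ∎
      where
      open ℚ.≤-Reasoning
      l : ℕ
      l = length (centres s)
      w : ℚ
      w = (ν C ℚ.+ ν C) ℚ.* ρ a
      0≤w : 0ℚ ℚ.≤ w
      0≤w = subst (ℚ._≤ w) (ℚ.*-zeroˡ (ρ a)) (*-monoʳ (ρ a) (ℚ.<⇒≤ (0<ρ a)) (ℚ.+-mono-≤ (0≤ν C) (0≤ν C)))
      rearrange : ∀ x y z → x ℚ.* (y ℚ.* z) ≡ y ℚ.* x ℚ.* z
      rearrange = solve 3 (λ x y z → x :* (y :* z) := y :* x :* z) refl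

    near⇒inside : ∀ α t → Eventually (λ n → Near (seq α n) a t) → α inside interval t
    near⇒inside α t near =
      (ρ a , 0<ρ a , Eventually-map (λ n → near⇒lo< {seq α n} {t}) near) ,
      (ρ a , 0<ρ a , Eventually-map (λ n → near⇒<hi {seq α n} {t}) near)

    intervals-cover : ∀ α → Trapped α → Any (α inside_) intervals
    intervals-cover α trapped =
      let t , t∈ , near = trapped⇒near α trapped s
      in Any.map⁺ (Any.map (λ { refl → near⇒inside α t near }) t∈)

  trapped-coverable : Coverable Trapped
  trapped-coverable η 0<η =
    -- The depth s = D + 1 satisfies 2 C ≤ s η; since s ≤ 2 ^ s, the total length 2 C / 2 ^ s is at
    -- most η.
    let D , 2C≤Dη = archimedean (ν C ℚ.+ ν C) η 0<η
    in intervals (suc D) , total-small (suc D) 2C≤Dη , intervals-cover (suc D)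
    where
    open ℚ.≤-Reasoning
    total-small : ∀ D → ν C ℚ.+ ν C ℚ.≤ ν D ℚ.* η → total (intervals D) ℚ.≤ η
    total-small D 2C≤Dη = begin
      total (intervals D)              ≤⟨ total-intervals D ⟩
      halve D (ν C ℚ.+ ν C)            ≤⟨ halve-mono D 2C≤Dη ⟩
      halve D (ν D ℚ.* η)              ≤⟨ halve-mono D (*-monoʳ η (ℚ.<⇒≤ 0<η) (ν-mono (n≤2^n D))) ⟩
      halve D (ν (2 ℕ.^ D) ℚ.* η)      ≡⟨ *-halve (ν (2 ℕ.^ D)) D η ⟨
      ν (2 ℕ.^ D) ℚ.* halve D η        ≡⟨ 2^*halve D η ⟩
      η                                ∎

-- Separated sequences

-- If the first 2 n + 1 values all had absolute value below n, adding n would place them among 2 n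
-- natural numbers, against the pigeonhole principle. The search over these finitely many indices is
-- decidable, which makes the witness explicit.
injective⇒unbounded : (g : ℕ → ℤ) → Injective _≡_ _≡_ g → ∀ n → ∃[ j ] n ℕ.≤ ℤ.∣ g j ∣
injective⇒unbounded g g-injective n
  with Fin.any? {suc (n ℕ.+ n)} (λ j → n ℕ.≤? ℤ.∣ g (Fin.toℕ j) ∣)
... | yes (j , n≤∣gj∣) = Fin.toℕ j , n≤∣gj∣
... | no  small =
  let i , j , i<j , eq = Fin.pigeonhole (ℕ.n<1+n (n ℕ.+ n)) (λ i → Fin.fromℕ< (shifted< i))
  in contradiction (g-injective (shift-injective i j (begin
       ℤ.∣ g (Fin.toℕ i) ℤ.+ + n ∣            ≡⟨ Fin.toℕ-fromℕ< (shifted< i) ⟨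
       Fin.toℕ (Fin.fromℕ< (shifted< i))      ≡⟨ cong Fin.toℕ eq ⟩
       Fin.toℕ (Fin.fromℕ< (shifted< j))      ≡⟨ Fin.toℕ-fromℕ< (shifted< j) ⟩
       ℤ.∣ g (Fin.toℕ j) ℤ.+ + n ∣            ∎)))
     (ℕ.<⇒≢ i<j)
  where
  open ≡-Reasoning
  ∣g∣<n : ∀ i → ℤ.∣ g (Fin.toℕ i) ∣ ℕ.< n
  ∣g∣<n i = ℕ.≰⇒> (λ n≤ → small (i , n≤))
  shifted< : ∀ i → ℤ.∣ g (Fin.toℕ i) ℤ.+ + n ∣ ℕ.< n ℕ.+ n
  shifted< i = ℕ.≤-<-trans (ℤ.∣i+j∣≤∣i∣+∣j∣ (g (Fin.toℕ i)) (+ n)) (ℕ.+-monoˡ-< n (∣g∣<n i))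
  -- Adding n makes the values nonnegative, so that nothing is lost by taking absolute values.
  0≤shifted : ∀ i → + 0 ℤ.≤ g (Fin.toℕ i) ℤ.+ + n
  0≤shifted i = subst (+ 0 ℤ.≤_) (rearrange (g (Fin.toℕ i)) (+ n)) (ℤ.i≤j⇒0≤j-i
    (ℤ.≤-trans (i≤+∣i∣ (ℤ.- g (Fin.toℕ i))) (ℤ.+≤+ (subst (ℕ._≤ n) (sym (ℤ.∣-i∣≡∣i∣ (g (Fin.toℕ i)))) (ℕ.<⇒≤ (∣g∣<n i))))))
    where
    rearrange : ∀ x y → y ℤ.- (ℤ.- x) ≡ x ℤ.+ y
    rearrange = ℤ.solve-∀
  shift-injective : ∀ i j → ℤ.∣ g (Fin.toℕ i) ℤ.+ + n ∣ ≡ ℤ.∣ g (Fin.toℕ j) ℤ.+ + n ∣ → g (Fin.toℕ i) ≡ g (Fin.toℕ j)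
  shift-injective i j eq = ℤ-+.∙-cancelʳ (+ n) (g (Fin.toℕ i)) (g (Fin.toℕ j)) (begin
    g (Fin.toℕ i) ℤ.+ + n                  ≡⟨ ℤ.0≤i⇒+∣i∣≡i (0≤shifted i) ⟨
    + ℤ.∣ g (Fin.toℕ i) ℤ.+ + n ∣          ≡⟨ cong +_ eq ⟩
    + ℤ.∣ g (Fin.toℕ j) ℤ.+ + n ∣          ≡⟨ ℤ.0≤i⇒+∣i∣≡i (0≤shifted j) ⟩
    g (Fin.toℕ j) ℤ.+ + n                  ∎)

∣p-q∣≤ : ∀ {p q r s} → ℚ.∣ p ∣ ℚ.≤ r → ℚ.∣ q ∣ ℚ.≤ s → ℚ.∣ p ℚ.- q ∣ ℚ.≤ r ℚ.+ s
∣p-q∣≤ {p} {q} p≤r q≤s = ℚ.≤-trans (ℚ.∣p-q∣≤∣p∣+∣q∣ p q) (ℚ.+-mono-≤ p≤r q≤s)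

∣p+q∣≤ : ∀ {p q r s} → ℚ.∣ p ∣ ℚ.≤ r → ℚ.∣ q ∣ ℚ.≤ s → ℚ.∣ p ℚ.+ q ∣ ℚ.≤ r ℚ.+ s
∣p+q∣≤ {p} {q} p≤r q≤s = ℚ.≤-trans (ℚ.∣p+q∣≤∣p∣+∣q∣ p q) (ℚ.+-mono-≤ p≤r q≤s)

∣p*q∣≤ : ∀ {p q r s} → ℚ.∣ p ∣ ℚ.≤ r → ℚ.∣ q ∣ ℚ.≤ s → 0ℚ ℚ.≤ r → ℚ.∣ p ℚ.* q ∣ ℚ.≤ r ℚ.* s
∣p*q∣≤ {p} {q} {r} {s} p≤r q≤s 0≤r = begin
  ℚ.∣ p ℚ.* q ∣            ≡⟨ ℚ.∣p*q∣≡∣p∣*∣q∣ p q ⟩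
  ℚ.∣ p ∣ ℚ.* ℚ.∣ q ∣      ≤⟨ *-monoʳ ℚ.∣ q ∣ (ℚ.0≤∣p∣ q) p≤r ⟩
  r ℚ.* ℚ.∣ q ∣            ≤⟨ *-monoˡ r 0≤r q≤s ⟩
  r ℚ.* s                  ∎
  where open ℚ.≤-Reasoning

∣ν∣ : ∀ n → ℚ.∣ ν n ∣ ≡ ν n
∣ν∣ n = ℚ.0≤p⇒∣p∣≡p (0≤ν n)

bounded : ∀ x → ∃[ T ] Eventually (λ n → ℚ.∣ seq x n ∣ ℚ.≤ ν T)
bounded x =
  let N , close = cauchy x 1ℚ (ℚ.positive⁻¹ 1ℚ)
      T , ∣xN∣+1≤T = ≤ν (1ℚ ℚ.+ ℚ.∣ seq x N ∣)
  in suc T , N , λ n N≤n → ℚ.≤-trans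
       (subst (λ y → ℚ.∣ y ∣ ℚ.≤ 1ℚ ℚ.+ ℚ.∣ seq x N ∣) (cancel (seq x n) (seq x N))
         (∣p+q∣≤ {seq x n ℚ.- seq x N} {seq x N} (close n N N≤n ℕ.≤-refl) ℚ.≤-refl))
       ∣xN∣+1≤T
  where
  cancel : ∀ p q → p ℚ.- q ℚ.+ q ≡ p
  cancel = solve 2 (λ p q → p :- q :+ q := p) refl

-- A rational form of the hypothesis on the infimum: the gap `g` is common to all pairs, and only
-- the start of the tail depends on the pair.
Separated : (ℕ → ℝ) → ℚ → Set
Separated Λ g = ∀ m n → m ≢ n → Eventually (λ k → g ℚ.≤ ℚ.∣ seq (Λ m) k ℚ.- seq (Λ n) k ∣)

≃-refl : ∀ x → x ≃ x
≃-refl x ε 0<ε = 0 , λ n _ → subst (λ y → ℚ.∣ y ∣ ℚ.≤ ε) (sym (ℚ.+-inverseʳ (seq x n))) (ℚ.<⇒≤ 0<ε)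

-- Of the rational `e` that eventually bounds δ from below, one half absorbs the tolerance in the
-- inequality between δ and the distance; the other half is the gap.
inf>0⇒separated : ∀ Λ → inf (Distances Λ) > 0ℝ → ∃[ g ] 0ℚ ℚ.< g × Separated Λ g
inf>0⇒separated Λ (δ , (e , 0<e , e≤δ) , δ≤) = ½ ℚ.* e , 0<halve 1 0<e , λ m n m≢n →
  Eventually-map (λ k (h₁ , h₂) → gap h₁ h₂) (Eventually-× e≤δ
    (δ≤ ∣ Λ m - Λ n ∣ (m , n , m≢n , ≃-refl ∣ Λ m - Λ n ∣) (½ ℚ.* e) (0<halve 1 0<e)))
  where
  open ℚ.≤-Reasoning
  gap : ∀ {d r} → 0ℚ ℚ.+ e ℚ.≤ d → d ℚ.≤ r ℚ.+ ½ ℚ.* e → ½ ℚ.* e ℚ.≤ r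
  gap {d} {r} e≤d d≤r+½e = begin
    ½ ℚ.* e                              ≡⟨ split e ⟩
    0ℚ ℚ.+ e ℚ.- ½ ℚ.* e                 ≤⟨ ℚ.+-monoˡ-≤ (ℚ.- (½ ℚ.* e)) (ℚ.≤-trans e≤d d≤r+½e) ⟩
    r ℚ.+ ½ ℚ.* e ℚ.- ½ ℚ.* e            ≡⟨ cancel r (½ ℚ.* e) ⟩
    r                                    ∎
    where
    split : ∀ e → ½ ℚ.* e ≡ 0ℚ ℚ.+ e ℚ.- ½ ℚ.* e
    split = solve 1 (λ e → con ½ :* e := con 0ℚ :+ e :- con ½ :* e) refl
    cancel : ∀ p q → p ℚ.+ q ℚ.- q ≡ p
    cancel = solve 2 (λ p q → p :+ q :- q := p) refl

approximate : ∀ D .{{_ : ℕ.NonZero D}} (x : ℝ) →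
  ∃[ z ] Eventually (λ n → ℚ.∣ ν D ℚ.* seq x n ℚ.- ι z ∣ ℚ.≤ ν 2)
approximate D x =
  let N , close = cauchy x (ρ D) (0<ρ D)
      z , z≤ , ≤1+z = ι-floor (ν D ℚ.* seq x N)
  in z , N , λ n N≤n → subst₂ (λ p q → ℚ.∣ p ∣ ℚ.≤ q) (split (ν D) (seq x n) (seq x N) (ι z)) 1+1
       (∣p+q∣≤ {ν D ℚ.* (seq x n ℚ.- seq x N)} {ν D ℚ.* seq x N ℚ.- ι z}
         (subst (ℚ.∣ ν D ℚ.* (seq x n ℚ.- seq x N) ∣ ℚ.≤_) (ν*ρ D)
           (∣p*q∣≤ {ν D} (ℚ.≤-reflexive (∣ν∣ D)) (close n N N≤n ℕ.≤-refl) (0≤ν D)))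
         (abs-≤ (p-z≤1 ≤1+z) (z-p≤1 z≤)))
  where
  open ℚ.≤-Reasoning
  1+1 : 1ℚ ℚ.+ 1ℚ ≡ ν 2
  1+1 = sym (trans (ν-suc 1) (cong (1ℚ ℚ.+_) (ι≡/1 (+ 1))))
  split : ∀ d p q z → d ℚ.* (p ℚ.- q) ℚ.+ (d ℚ.* q ℚ.- z) ≡ d ℚ.* p ℚ.- z
  split = solve 4 (λ d p q z → d :* (p :- q) :+ (d :* q :- z) := d :* p :- z) refl
  p-z≤1 : ∀ {p z} → p ℚ.≤ 1ℚ ℚ.+ z → p ℚ.- z ℚ.≤ 1ℚ
  p-z≤1 {p} {z} p≤1+z = ℚ.≤-trans (ℚ.+-monoˡ-≤ (ℚ.- z) p≤1+z) (ℚ.≤-reflexive (cancel z))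
    where
    cancel : ∀ z → 1ℚ ℚ.+ z ℚ.- z ≡ 1ℚ
    cancel = solve 1 (λ z → con 1ℚ :+ z :- z := con 1ℚ) refl
  z-p≤1 : ∀ {p z} → z ℚ.≤ p → ℚ.- (p ℚ.- z) ℚ.≤ 1ℚ
  z-p≤1 {p} {z} z≤p = begin
    ℚ.- (p ℚ.- z)     ≡⟨ swap p z ⟩
    z ℚ.- p           ≤⟨ ℚ.+-monoˡ-≤ (ℚ.- p) z≤p ⟩
    p ℚ.- p           ≡⟨ ℚ.+-inverseʳ p ⟩
    0ℚ                ≤⟨ ℚ.nonNegative⁻¹ 1ℚ ⟩
    1ℚ                ∎
    where
    swap : ∀ p z → ℚ.- (p ℚ.- z) ≡ z ℚ.- p
    swap = solve 2 (λ p z → :- (p :- z) := z :- p) refl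

-- The exceptional set is null

Exceptional : (ℕ → ℝ) → Pred ℝ 0ℓ
Exceptional Λ α = Σ[ f ∈ (ℕ → ℤ) ] IntegralDifferenceRatios f ×
  UniformlyClose (λ n → α * Λ n) (λ n → fromℤ (f n))

module _ (Λ : ℕ → ℝ) (g : ℚ) (separated : Separated Λ g)
         (D-1 : ℕ) (5≤Dg : ν 5 ℚ.≤ ν (suc D-1) ℚ.* g) where

  private
    D : ℕ
    D = suc D-1

  -- Only guaranteed to be within 2 of D Λ n, not to be the closest integer.
  nearest : ℕ → ℤ
  nearest n = proj₁ (approximate D (Λ n))

  nearest-close : ∀ n → Eventually (λ k → ℚ.∣ ν D ℚ.* seq (Λ n) k ℚ.- ι (nearest n) ∣ ℚ.≤ ν 2)
  nearest-close n = proj₂ (approximate D (Λ n))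

  -- Two terms with the same approximation would satisfy D |Λ m - Λ n| ≤ 2 + 2, while separation
  -- gives D |Λ m - Λ n| ≥ D g ≥ 5.
  nearest-injective : Injective _≡_ _≡_ nearest
  nearest-injective {m} {n} eq with m ℕ.≟ n
  ... | yes m≡n = m≡n
  ... | no  m≢n =
    let N , both = Eventually-× (separated m n m≢n) (Eventually-× (nearest-close m) (nearest-close n))
        gap , close-m , close-n = both N ℕ.≤-refl
    in contradiction (too-close gap close-m (subst (λ z → ℚ.∣ ν D ℚ.* seq (Λ n) N ℚ.- ι z ∣ ℚ.≤ ν 2) (sym eq) close-n)) 5≰4
    where
    5≰4 : ¬ (ν 5 ℚ.≤ ν 2 ℚ.+ ν 2)
    5≰4 5≤4 = ℚ.<-irrefl (ι-+ (+ 2) (+ 2)) (ℚ.<-≤-trans (ι-mono-< {+ 4} {+ 5} (ℤ.+<+ ℕ.≤-refl)) 5≤4)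
    too-close : ∀ {x y z} → g ℚ.≤ ℚ.∣ x ℚ.- y ∣ → ℚ.∣ ν D ℚ.* x ℚ.- z ∣ ℚ.≤ ν 2 → ℚ.∣ ν D ℚ.* y ℚ.- z ∣ ℚ.≤ ν 2 →
      ν 5 ℚ.≤ ν 2 ℚ.+ ν 2
    too-close {x} {y} {z} gap close-x close-y = begin
      ν 5                                                  ≤⟨ 5≤Dg ⟩
      ν D ℚ.* g                                            ≤⟨ *-monoˡ (ν D) (0≤ν D) gap ⟩
      ν D ℚ.* ℚ.∣ x ℚ.- y ∣                                ≡⟨ cong (ℚ._* ℚ.∣ x ℚ.- y ∣) (∣ν∣ D) ⟨
      ℚ.∣ ν D ∣ ℚ.* ℚ.∣ x ℚ.- y ∣                          ≡⟨ ℚ.∣p*q∣≡∣p∣*∣q∣ (ν D) (x ℚ.- y) ⟨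
      ℚ.∣ ν D ℚ.* (x ℚ.- y) ∣                              ≡⟨ cong ℚ.∣_∣ (split (ν D) x y z) ⟩
      ℚ.∣ (ν D ℚ.* x ℚ.- z) ℚ.- (ν D ℚ.* y ℚ.- z) ∣        ≤⟨ ∣p-q∣≤ {ν D ℚ.* x ℚ.- z} {ν D ℚ.* y ℚ.- z} close-x close-y ⟩
      ν 2 ℚ.+ ν 2                                          ∎
      where
      open ℚ.≤-Reasoning
      split : ∀ d x y z → d ℚ.* (x ℚ.- y) ≡ (d ℚ.* x ℚ.- z) ℚ.- (d ℚ.* y ℚ.- z)
      split = solve 4 (λ d x y z → d :* (x :- y) := (d :* x :- z) :- (d :* y :- z)) refl

  module _ (T : ℕ) where

    -- Chosen so that D * modulus ≡ 8 * suc slack and errors≤slack hold.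
    modulus slack : ℕ
    modulus = 8 ℕ.* suc (6 ℕ.* T)
    slack   = 6 ℕ.* T ℕ.+ D-1 ℕ.* suc (6 ℕ.* T)

    -- The integer substitute for D (Λ n - Λ 0) at n = modulus (j + 1); the shift by one keeps n
    -- different from 0, as difference ratios require.
    increment : ℕ → ℤ
    increment j = nearest (modulus ℕ.* suc j) ℤ.- nearest 0

    increment-injective : Injective _≡_ _≡_ increment
    increment-injective {i} {j} eq = ℕ.suc-injective (ℕ.*-cancelˡ-≡ (suc i) (suc j) modulus
      (nearest-injective (ℤ-+.∙-cancelʳ (ℤ.- nearest 0) _ _ eq)))

    open Refinement slack increment (injective⇒unbounded increment increment-injective) public
      using (Trapped; trapped-coverable)

    T≤slack : T ℕ.≤ slack
    T≤slack = ℕ.≤-trans (ℕ.m≤m+n T (5 ℕ.* T)) (ℕ.m≤m+n (6 ℕ.* T) _)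

    -- The left-hand side is the error in `estimate`: two closeness errors T scaled by D, and two
    -- approximation errors 2 scaled by the bound T on |α|.
    errors≤slack : ν D ℚ.* (ν T ℚ.+ ν T) ℚ.+ ν T ℚ.* (ν 2 ℚ.+ ν 2) ℚ.≤ ν slack
    errors≤slack = begin
      ν D ℚ.* (ν T ℚ.+ ν T) ℚ.+ ν T ℚ.* (ν 2 ℚ.+ ν 2)
        ≡⟨ cong₂ ℚ._+_ (trans (ν-* D (T ℕ.+ T)) (cong (ν D ℚ.*_) (ι-+ (+ T) (+ T)))) (trans (ν-* T 4) (cong (ν T ℚ.*_) (ι-+ (+ 2) (+ 2)))) ⟨
      ν (D ℕ.* (T ℕ.+ T)) ℚ.+ ν (T ℕ.* 4)
        ≡⟨ ι-+ (+ (D ℕ.* (T ℕ.+ T))) (+ (T ℕ.* 4)) ⟨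
      ν (D ℕ.* (T ℕ.+ T) ℕ.+ T ℕ.* 4)
        -- The amount by which `slack` exceeds the errors is (D - 1) (4 T + 1).
        ≤⟨ ν-mono (subst (D ℕ.* (T ℕ.+ T) ℕ.+ T ℕ.* 4 ℕ.≤_) (split D-1 T) (ℕ.m≤m+n _ (D-1 ℕ.* suc (4 ℕ.* T)))) ⟩
      ν slack ∎
      where
      open ℚ.≤-Reasoning
      split : ∀ d T → (1 ℕ.+ d) ℕ.* (T ℕ.+ T) ℕ.+ T ℕ.* 4 ℕ.+ d ℕ.* (1 ℕ.+ 4 ℕ.* T) ≡ 6 ℕ.* T ℕ.+ d ℕ.* (1 ℕ.+ 6 ℕ.* T)
      split = ℕ.solve-∀

    -- Divisibility gives f n - f 0 = u n for n = modulus (j + 1). Multiplied by D, this becomes 8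
    -- (slack + 1) times u (j + 1), so u (j + 1) is the integer required by `Trapped`.
    close⇒trapped : ∀ α f → IntegralDifferenceRatios f →
      Eventually (λ k → ℚ.∣ seq α k ∣ ℚ.≤ ν T) →
      (∀ n → Eventually (λ k → ℚ.∣ seq α k ℚ.* seq (Λ n) k ℚ.- ι (f n) ∣ ℚ.≤ ν T)) →
      Trapped α
    close⇒trapped α f idr α≤T close = Eventually-map (λ k h → ℚ.≤-trans h (ν-mono T≤slack)) α≤T , λ j →
      let n = modulus ℕ.* suc j
          divides u eq = idr n 0 (λ ())
      in u ℤ.* + suc j , Eventually-map
           (λ k (a , (x , y) , (cx , cy)) → estimate {seq α k} {seq (Λ n) k} {seq (Λ 0) k} n 0 (u ℤ.* + suc j) (scaled j u eq) a x y cx cy)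
           (Eventually-× α≤T (Eventually-× (Eventually-× (close n) (close 0)) (Eventually-× (nearest-close n) (nearest-close 0))))
      where
      scaled : ∀ j u → f (modulus ℕ.* suc j) ℤ.- f 0 ≡ u ℤ.* (+ (modulus ℕ.* suc j) ℤ.- + 0) →
        + D ℤ.* (f (modulus ℕ.* suc j) ℤ.- f 0) ≡ + (8 ℕ.* suc slack) ℤ.* (u ℤ.* + suc j)
      scaled j u eq = begin
        + D ℤ.* (f (modulus ℕ.* suc j) ℤ.- f 0)
          ≡⟨ cong (+ D ℤ.*_) eq ⟩
        + D ℤ.* (u ℤ.* (+ (modulus ℕ.* suc j) ℤ.- + 0))
          ≡⟨ cong (λ z → + D ℤ.* (u ℤ.* (z ℤ.- + 0))) (trans (ℤ.pos-* modulus (suc j)) (cong (ℤ._* + suc j) (ℤ.pos-* 8 (suc (6 ℕ.* T))))) ⟩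
        + D ℤ.* (u ℤ.* (+ 8 ℤ.* + suc (6 ℕ.* T) ℤ.* + suc j ℤ.- + 0))
          ≡⟨ rearrange (+ D) u (+ suc (6 ℕ.* T)) (+ suc j) ⟩
        + 8 ℤ.* (+ D ℤ.* + suc (6 ℕ.* T)) ℤ.* (u ℤ.* + suc j)
          ≡⟨ cong (λ z → + 8 ℤ.* z ℤ.* (u ℤ.* + suc j)) (ℤ.pos-* D (suc (6 ℕ.* T))) ⟨
        + 8 ℤ.* + suc slack ℤ.* (u ℤ.* + suc j)
          ≡⟨ cong (ℤ._* (u ℤ.* + suc j)) (ℤ.pos-* 8 (suc slack)) ⟨
        + (8 ℕ.* suc slack) ℤ.* (u ℤ.* + suc j) ∎
        where
        open ≡-Reasoning
        rearrange : ∀ d u m j → d ℤ.* (u ℤ.* (+ 8 ℤ.* m ℤ.* j ℤ.- + 0)) ≡ + 8 ℤ.* (d ℤ.* m) ℤ.* (u ℤ.* j)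
        rearrange = ℤ.solve-∀
      estimate : ∀ {a x y} m n t → + D ℤ.* (f m ℤ.- f n) ≡ + (8 ℕ.* suc slack) ℤ.* t →
        ℚ.∣ a ∣ ℚ.≤ ν T → ℚ.∣ a ℚ.* x ℚ.- ι (f m) ∣ ℚ.≤ ν T → ℚ.∣ a ℚ.* y ℚ.- ι (f n) ∣ ℚ.≤ ν T →
        ℚ.∣ ν D ℚ.* x ℚ.- ι (nearest m) ∣ ℚ.≤ ν 2 → ℚ.∣ ν D ℚ.* y ℚ.- ι (nearest n) ∣ ℚ.≤ ν 2 →
        ℚ.∣ a ℚ.* ι (nearest m ℤ.- nearest n) ℚ.- ν (8 ℕ.* suc slack) ℚ.* ι t ∣ ℚ.≤ ν slack
      estimate {a} {x} {y} m n t eq a≤T ax≈F ay≈G Dx≈p Dy≈q = begin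
        ℚ.∣ a ℚ.* ι (nearest m ℤ.- nearest n) ℚ.- ν (8 ℕ.* suc slack) ℚ.* ι t ∣
          ≡⟨ cong₂ (λ v w → ℚ.∣ a ℚ.* v ℚ.- w ∣) (ι-minus (nearest m) (nearest n)) Kt ⟩
        ℚ.∣ a ℚ.* (p ℚ.- q) ℚ.- ν D ℚ.* (F ℚ.- G) ∣
          -- Adding and subtracting D a (x - y) leaves only closeness errors and approximation
          -- errors.
          ≡⟨ cong ℚ.∣_∣ (rearrange a p q (ν D) F G x y) ⟩
        ℚ.∣ ν D ℚ.* ((a ℚ.* x ℚ.- F) ℚ.- (a ℚ.* y ℚ.- G)) ℚ.- a ℚ.* ((ν D ℚ.* x ℚ.- p) ℚ.- (ν D ℚ.* y ℚ.- q)) ∣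
          ≤⟨ ∣p-q∣≤ {ν D ℚ.* ((a ℚ.* x ℚ.- F) ℚ.- (a ℚ.* y ℚ.- G))} {a ℚ.* ((ν D ℚ.* x ℚ.- p) ℚ.- (ν D ℚ.* y ℚ.- q))}
               (∣p*q∣≤ {ν D} (ℚ.≤-reflexive (∣ν∣ D)) (∣p-q∣≤ {a ℚ.* x ℚ.- F} {a ℚ.* y ℚ.- G} ax≈F ay≈G) (0≤ν D))
               (∣p*q∣≤ {a} a≤T (∣p-q∣≤ {ν D ℚ.* x ℚ.- p} {ν D ℚ.* y ℚ.- q} Dx≈p Dy≈q) (0≤ν T)) ⟩
        ν D ℚ.* (ν T ℚ.+ ν T) ℚ.+ ν T ℚ.* (ν 2 ℚ.+ ν 2)
          ≤⟨ errors≤slack ⟩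
        ν slack ∎
        where
        open ℚ.≤-Reasoning
        p q F G : ℚ
        p = ι (nearest m)
        q = ι (nearest n)
        F = ι (f m)
        G = ι (f n)
        Kt : ν (8 ℕ.* suc slack) ℚ.* ι t ≡ ν D ℚ.* (F ℚ.- G)
        Kt = begin-equality
          ν (8 ℕ.* suc slack) ℚ.* ι t           ≡⟨ ι-* (+ (8 ℕ.* suc slack)) t ⟨
          ι (+ (8 ℕ.* suc slack) ℤ.* t)         ≡⟨ cong ι eq ⟨
          ι (+ D ℤ.* (f m ℤ.- f n))             ≡⟨ ι-* (+ D) (f m ℤ.- f n) ⟩
          ν D ℚ.* ι (f m ℤ.- f n)               ≡⟨ cong (ν D ℚ.*_) (ι-minus (f m) (f n)) ⟩
          ν D ℚ.* (F ℚ.- G)                     ∎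
        rearrange : ∀ a p q d F G x y → a ℚ.* (p ℚ.- q) ℚ.- d ℚ.* (F ℚ.- G) ≡
          d ℚ.* ((a ℚ.* x ℚ.- F) ℚ.- (a ℚ.* y ℚ.- G)) ℚ.- a ℚ.* ((d ℚ.* x ℚ.- p) ℚ.- (d ℚ.* y ℚ.- q))
        rearrange = solve 8 (λ a p q d F G x y → a :* (p :- q) :- d :* (F :- G) :=
          d :* ((a :* x :- F) :- (a :* y :- G)) :- a :* ((d :* x :- p) :- (d :* y :- q))) refl

  exceptional-null : Null (Exceptional Λ)
  exceptional-null = coverable-⋃⇒null Trapped trapped-coverable λ α (f , idr , M , close) →
    let S , α≤S = bounded α
        R , M≤R = bounded M
        -- One natural number bounds both |α| and M + 1, where the 1 is the tolerance spent on the
        -- real inequality in `close`.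
        T = S ℕ.+ suc R
    in T , close⇒trapped T α f idr
      (Eventually-map (λ k h → ℚ.≤-trans h (ν-mono (ℕ.m≤m+n S (suc R)))) α≤S)
      (λ n → Eventually-map
        (λ k (c≤M , m≤R) → ℚ.≤-trans (subst (λ z → ℚ.∣ seq α k ℚ.* seq (Λ n) k ℚ.- z ∣ ℚ.≤ seq M k ℚ.+ 1ℚ) (sym (ι≡/1 (f n))) c≤M) (M+1≤ {seq M k} {R} {T} (ℕ.m≤n+m (suc R) S) m≤R))
        (Eventually-× (close n 1ℚ (ℚ.positive⁻¹ 1ℚ)) M≤R))
    where
    open ℚ.≤-Reasoning
    M+1≤ : ∀ {m R T} → suc R ℕ.≤ T → ℚ.∣ m ∣ ℚ.≤ ν R → m ℚ.+ 1ℚ ℚ.≤ ν T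
    M+1≤ {m} {R} {T} R<T m≤R = begin
      m ℚ.+ 1ℚ           ≤⟨ ℚ.+-monoˡ-≤ 1ℚ (ℚ.≤-trans (p≤∣p∣ m) m≤R) ⟩
      ν R ℚ.+ 1ℚ         ≡⟨ ℚ.+-comm (ν R) 1ℚ ⟩
      1ℚ ℚ.+ ν R         ≡⟨ ν-suc R ⟨
      ν (suc R)          ≤⟨ ν-mono R<T ⟩
      ν T                ∎

theorem4p9 : (Λ : ℕ → ℝ) → inf (Distances Λ) > 0ℝ →
    AlmostAll (λ α → ¬ (Σ[ f ∈ (ℕ → ℤ) ] IntegralDifferenceRatios f ×
    UniformlyClose (λ n → α * Λ n) (λ n → fromℤ (f n))))
theorem4p9 Λ inf>0 =
  let g , 0<g , separated = inf>0⇒separated Λ inf>0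
      D-1 , 5≤Dg          = archimedean (ν 5) g 0<g
  in Exceptional Λ , exceptional-null Λ g separated D-1 5≤Dg , λ _ ¬exceptional → ¬exceptional
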